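{- Let $m\ge 2$ be an integer and let $\mathcal{F}$ be a family of connected bipartite graphs, each having at least $m$ edges. Let $k_v^{\le m}$ be the number of graphs in $\mathcal{F}$ with at most $m$ vertices and $k_e^m$ the number of graphs in $\mathcal{F}$ with exactly $m$ edges. Then $$\chi_{2,\mathcal{F}}(\Delta) < (k_v^{\le m}+71)(m+1)\Delta^{\frac{m}{m-1}}$$ and $$\chi_{2,\mathcal{F}}(\Delta) < \left(k_e^m + 1 + o(1)\right)(m+1)\Delta^{\frac{m}{m-1}},$$ where $o(1)$ tends to $0$ as $\Delta\to\infty$.
   Context: A $(2,\mathcal{F})$-subgraph coloring of a graph $G$ is a proper vertex-coloring of $G$ such that, for any two color classes, the subgraph of $G$ induced by their union contains no subgraph isomorphic to any $H\in\mathcal{F}$. $\chi_{2,\mathcal{F}}(G)$ is the minimum number of colors of such a coloring, and $\chi_{2,\mathcal{F}}(\Delta)$ is the maximum of $\chi_{2,\mathcal{F}}(G)$ over all graphs $G$ with maximum degree at most $\Delta$. Graphs in $\mathcal{F}$ are counted up to isomorphism. -}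

module Defs where

open import Data.Rational as ℚ using (ℚ; 0ℚ)
open import Algebra.Definitions.RawSemiring ℚ.+-*-rawSemiring using (_^_)
open import Data.Bool using (Bool; false; T)
open import Data.Bool.Properties using (T?)
open import Data.Fin using (Fin)
open import Data.Fin.Properties using (_<?_)
open import Data.Integer using (+_)
open import Data.List using (length; filter; allFin; cartesianProduct)
open import Data.Nat using (ℕ; _≤_)
open import Data.Product using (Σ-syntax; _×_; _,_; ∃-syntax)
open import Data.Rational.Literals using (fromℤ)
open import Data.Sum using (_⊎_)
open import Function.Bundles using (_↔_; module Inverse)
open import Function.Definitions using (Injective)
open import Level using (0ℓ)
open import Relation.Binary.Construct.Closure.ReflexiveTransitive using (Star)
open import Relation.Binary.PropositionalEquality using (_≡_; _≢_)
open import Relation.Nullary using (¬_)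
open import Relation.Nullary.Decidable using (_×-dec_)
open import Relation.Unary using (Pred)

-- Finite simple graphs, with vertex set Fin order.

record Graph : Set where
  field
    order  : ℕ
    adj    : Fin order → Fin order → Bool
    symm   : ∀ u v → adj u v ≡ adj v u
    irrefl : ∀ v → adj v v ≡ false

  Vertex : Set
  Vertex = Fin order

  Adj : Vertex → Vertex → Set
  Adj u v = T (adj u v)

  degree : Vertex → ℕ
  degree v = length (filter (λ w → T? (adj v w)) (allFin order))

  -- Each edge is counted once, as the pair (u , v) with u < v.
  size : ℕ
  size = length (filter (λ (u , v) → (u <? v) ×-dec T? (adj u v))
                        (cartesianProduct (allFin order) (allFin order)))

  Connected : Set
  Connected = ∀ u v → Star Adj u v

  Bipartite : Set
  Bipartite = Σ[ side ∈ (Vertex → Bool) ] (∀ u v → Adj u v → side u ≢ side v)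

  MaxDegree≤ : ℕ → Set
  MaxDegree≤ Δ = ∀ v → degree v ≤ Δ

open Graph public

record _≅_ (G H : Graph) : Set where
  field
    bijection : Vertex G ↔ Vertex H
    preserves : ∀ u v → adj G u v ≡ adj H (Inverse.to bijection u) (Inverse.to bijection v)

-- A family may be infinite.  It need not be closed under isomorphism: it is
-- only ever used up to isomorphism.
Family : Set₁
Family = Pred Graph 0ℓ

-- k is the number of isomorphism classes of graphs satisfying P: there is an
-- irredundant and complete list of k representatives.
NumberUpToIso : Pred Graph 0ℓ → ℕ → Set
NumberUpToIso P k =
  Σ[ rep ∈ (Fin k → Graph) ]
    (∀ i → P (rep i))
    × (∀ i j → rep i ≅ rep j → i ≡ j)
    × (∀ H → P H → ∃[ i ] (H ≅ rep i))

-- The subgraph of G induced by S contains a (not necessarily induced)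
-- subgraph isomorphic to H.
InducedContains : (G : Graph) → Pred (Vertex G) 0ℓ → Graph → Set
InducedContains G S H =
  Σ[ f ∈ (Vertex H → Vertex G) ]
    Injective _≡_ _≡_ f
    × (∀ u v → Adj H u v → Adj G (f u) (f v))
    × (∀ u → S (f u))

module _ (F : Family) where

  record IsSubgraphColoring (G : Graph) (c : ℕ) (color : Vertex G → Fin c) : Set where
    field
      proper : ∀ u v → Adj G u v → color u ≢ color v
      avoids : ∀ a b → a ≢ b → ∀ H → F H →
               ¬ InducedContains G (λ v → color v ≡ a ⊎ color v ≡ b) H

  Colorable : Graph → ℕ → Set
  Colorable G c = Σ[ color ∈ (Vertex G → Fin c) ] IsSubgraphColoring G c color

  -- c = χ_{2,F}(G)
  IsChromaticNumber : Graph → ℕ → Set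
  IsChromaticNumber G c = Colorable G c × (∀ c′ → Colorable G c′ → c ≤ c′)

  -- M = χ_{2,F}(Δ), the maximum of χ_{2,F}(G) over the graphs G of maximum
  -- degree at most Δ.
  record IsMaxChromaticNumber (Δ M : ℕ) : Set where
    field
      attained   : ∃[ G ] (MaxDegree≤ G Δ × IsChromaticNumber G M)
      upperBound : ∀ G → MaxDegree≤ G Δ → ∃[ c ] (IsChromaticNumber G c × c ≤ M)

fromℕ : ℕ → ℚ
fromℕ n = fromℤ (+ n)

-- The inequality  c < C · x^(p/q)  between real numbers, for q ≥ 1.  As c ≥ 0,
-- it holds exactly when C ≥ 0 and the q-th powers of both sides compare; this
-- avoids irrational numbers.
infix 4 _<_·_^⟨_/_⟩
_<_·_^⟨_/_⟩ : ℕ → ℚ → ℕ → ℕ → ℕ → Set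
c < C · x ^⟨ p / q ⟩ = 0ℚ ℚ.≤ C × fromℕ c ^ q ℚ.< C ^ q ℚ.* fromℕ x ^ p

-- The error term o(1).  Rational values lose no generality in an upper bound:
-- a real null sequence is dominated by a rational one.
TendsToZero : (ℕ → ℚ) → Set
TendsToZero f = ∀ ε → 0ℚ ℚ.< ε → ∃[ N ] (∀ n → N ≤ n → ℚ.∣ f n ∣ ℚ.< ε)

{-# OPTIONS --safe #-}

-- Write Δ = y^(m-1), so that Δ^(m/(m-1)) = y^m.  Call a set of d ≤ m vertices
-- special if it has at least y^(m-d) common neighbours.  Double counting gives at
-- most y^(m(d-1)) special d-sets at a vertex, so one can insist that no special set
-- is monochromatic.  Then, in a two-coloured copy of a connected bipartite graph with
-- k vertices and e edges, a vertex adjacent to d earlier ones (these have the same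
-- colour, hence are not special) can be chosen in fewer than y^(m-d) ways, and so at
-- most y^(m(k-1)-e) copies start at a given vertex.
--
-- By Rosenfeld's counting argument, if every bad configuration at v determines the
-- colours of v and of r further vertices from the other colours, and the bad
-- configurations weighted by β^(-r) sum to at most C - β, then every vertex multiplies
-- the number of valid C-colourings by at least β.  A copy has r = k-3, because one
-- vertex of each colour other than v is kept (if there is none, then the copy is a star
-- at v, whose leaves form a special set), so with β ≈ y^m and e = m a copy type costs
-- y^m.  A member with more than m edges contains one of boundedly many configurations
-- with m+1 edges, which cost only y^m/y = Δ.  For the absolute bound, β is a larger
-- multiple of y^m: members with more than m vertices contain a tree with m edges, of
-- which breadth-first search produces at most 4^(m-1), and these are absorbed by β^(m-2).

module Submission where

open import Defs
open import Algebra.Bundles using (CommutativeMonoid)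
open import Axiom.ExcludedMiddle using (ExcludedMiddle)
open import Data.Bool using (Bool; true; false; T; not)
open import Data.Bool.Properties using (T?)
open import Data.Empty using (⊥-elim)
open import Data.Fin as Fin using (Fin; zero; suc; toℕ; inject₁; fromℕ<)
open import Data.Fin.Properties using (toℕ-inject₁; toℕ-injective; toℕ-fromℕ<; toℕ<n) renaming (_≟_ to _≟ᶠ_; _<?_ to _<?ᶠ_)
open import Data.Fin.Subset using (Subset; _-_; ⊤; ⊥; _⊆_; _⊂_) renaming (_∈_ to _∈ₛ_; _∉_ to _∉ₛ_)
open import Data.Fin.Subset.Induction using (⊂-wellFounded)
open import Data.Fin.Subset.Properties using (x∈p∧x≢y⇒x∈p-y; x∈p⇒p-x⊂p; p─q⊆p; ⊆-⊂-trans; ∈⊤; ∉⊥)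
import Data.Integer as ℤ
import Data.Integer.Properties as ℤ
open import Data.List using (List; []; _∷_; _++_; map; concatMap; filter; length; allFin; take; cartesianProduct; upTo)
open import Data.List.Membership.Propositional using (_∈_; _∉_; find)
open import Data.List.Membership.Propositional.Properties
open import Data.List.Properties using (length-++; length-map; length-tabulate; length-take; length-filter; map-∘)
open import Data.List.Relation.Binary.Permutation.Propositional using (_↭_; ↭⇒↭ₛ)
open import Data.List.Relation.Binary.Permutation.Propositional.Properties using (shift; ↭-length; All-resp-↭)
open import Data.List.Relation.Binary.Permutation.Setoid.Properties using (Unique-resp-↭)
open import Data.List.Relation.Unary.All as All using (All; []; _∷_)
import Data.List.Relation.Unary.All.Properties as All
open import Data.List.Relation.Unary.AllPairs as AllPairs using (AllPairs; []; _∷_)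
import Data.List.Relation.Unary.AllPairs.Properties as AllPairs
open import Data.List.Relation.Unary.Any as Any using (here; there)
open import Data.List.Relation.Unary.Unique.Propositional using (Unique)
import Data.List.Relation.Unary.Unique.Propositional.Properties as Unique
open import Data.Nat
open import Data.Nat.Properties
open import Data.Nat.Tactic.RingSolver using (solve-∀)
open import Data.Product using (_×_; _,_; proj₁; proj₂; ∃-syntax; Σ-syntax)
open import Data.Rational as ℚ using (ℚ; 0ℚ; mkℚ; toℚᵘ; fromℚᵘ)
import Data.Rational.Properties as ℚ
open import Data.Rational.Unnormalised using (mkℚᵘ; *≡*; *<*)
import Data.Rational.Unnormalised.Properties as ℚᵘ
open import Data.Sum using (_⊎_; inj₁; inj₂)
open import Data.Unit using (tt) renaming (⊤ to Unit)
open import Data.Vec as Vec using (Vec; []; _∷_; lookup; _[_]≔_)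
open import Data.Vec.Properties using (lookup∘update′; lookup-map; length-toList; toList∘fromList)
open import Function using (_∘_; id)
open import Function.Bundles using (Inverse)
open import Function.Definitions using (Injective)
open import Induction.WellFounded using (Acc; acc)
open import Level using (0ℓ)
open import Relation.Binary.Construct.Closure.ReflexiveTransitive using (Star; ε; _◅_)
open import Relation.Binary.PropositionalEquality
open import Relation.Nullary
open import Relation.Nullary.Decidable using (toWitness)
open import Relation.Unary using (Decidable)
open import Algebra.Definitions.RawSemiring ℚ.+-*-rawSemiring using () renaming (_^_ to _^ℚ_)
open import Algebra.Properties.CommutativeSemigroup (CommutativeMonoid.commutativeSemigroup ℚ.*-1-commutativeMonoid)
  using (xy∙z≈xz∙y) renaming (interchange to *-interchange)

-- Only integers and their q-th powers occur, with q = m - 1, since y is irrational in general: y^m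
-- is enclosed between its floor `H₀` and an integer x with `Δ ^ m ≤ x ^ q`. The absolute bound can
-- afford x = 2H₀; the asymptotic one takes x = H₀ + 1 and moves the rounding loss into o(1). F may
-- be infinite, and copies of different members cannot all be charged separately. A copy is
-- therefore charged to a pattern, a connected piece of it grown from a path h - y - x, where h is
-- the vertex that plays v. The cost of a pattern depends only on its numbers of vertices and edges,
-- so one pattern can serve infinitely many members. As v may play any vertex of a member, each
-- counted isomorphism class needs one pattern per vertex. Such a class has at most m vertices in
-- the absolute bound and at most m + 1 in the asymptotic one, whence the factor m + 1 next to the
-- number of classes. In the asymptotic bound the summand 1 beside that number pays for β and for
-- the m - 1 possible sizes of special sets, which is m times x in all.

private variable
  A B : Set

-- Powers and integer roots

^-distribʳ-* : ∀ a b n → (a * b) ^ n ≡ a ^ n * b ^ n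
^-distribʳ-* a b zero    = refl
^-distribʳ-* a b (suc n) = trans (cong (a * b *_) (^-distribʳ-* a b n)) (interchange a b (a ^ n) (b ^ n))
  where
  interchange : ∀ a b c d → (a * b) * (c * d) ≡ (a * c) * (b * d)
  interchange = solve-∀

^-swap : ∀ a n k → (a ^ n) ^ k ≡ (a ^ k) ^ n
^-swap a n k = trans (^-*-assoc a n k) (trans (cong (a ^_) (*-comm n k)) (sym (^-*-assoc a k n)))

^-cancelˡ-≤ : ∀ n .{{_ : NonZero n}} {a b} → a ^ n ≤ b ^ n → a ≤ b
^-cancelˡ-≤ n {a} {b} p with a ≤? b
... | yes a≤b = a≤b
... | no a≰b = ⊥-elim (<⇒≱ (^-monoˡ-< n (≰⇒> a≰b)) p)

^-cancelˡ-< : ∀ n {a b} → a ^ n < b ^ n → a < b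
^-cancelˡ-< n {a} {b} p with b ≤? a
... | yes b≤a = ⊥-elim (<⇒≱ p (^-monoˡ-≤ n b≤a))
... | no b≰a = ≰⇒> b≰a

-- Both halves matter for the thresholds: `N ≤ t ^ n` makes special sets few, and minimality of t
-- leaves few common neighbours to a set that is not special.
ceilingRoot : ∀ n .{{_ : NonZero n}} N → ∃[ t ] (N ≤ t ^ n × (∀ s → s < t → s ^ n < N))
ceilingRoot n zero = 0 , z≤n , λ _ ()
ceilingRoot n (suc N) with ceilingRoot n N
... | t , N≤ , below with suc N ≤? t ^ n
...   | yes N< = t , N< , λ s s<t → m<n⇒m<1+n (below s s<t)
...   | no N≮ = suc t , ≤-<-trans N≤ (^-monoˡ-< n (n<1+n t))
              , λ s s<1+t → ≤-<-trans (^-monoˡ-≤ n (≤-pred s<1+t)) (≰⇒> N≮)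

-- The least t with t^n at least N + 1 is one more than the floor of the root. That floor is at
-- least 1, and returning its predecessor makes it visibly nonzero.
floorRoot : ∀ n .{{_ : NonZero n}} N .{{_ : NonZero N}} → ∃[ h ] (suc h ^ n ≤ N × N < suc (suc h) ^ n)
floorRoot n (suc N) with ceilingRoot n (suc (suc N))
... | zero , le , _ = ⊥-elim (<⇒≱ le (subst (_≤ suc N) (sym (m≡0⇒m^n≡0 n)) z≤n))
  where
  m≡0⇒m^n≡0 : ∀ n .{{_ : NonZero n}} → 0 ^ n ≡ 0
  m≡0⇒m^n≡0 (suc _) = refl
... | suc zero , le , _ = ⊥-elim (<⇒≱ le (subst (_≤ suc N) (sym (^-zeroˡ n)) (s≤s z≤n)))
... | suc (suc h) , le , below = h , ≤-pred (below (suc h) ≤-refl) , le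

-- Sums over lists

∑ : List A → (A → ℕ) → ℕ
∑ []       f = 0
∑ (x ∷ xs) f = f x + ∑ xs f

∑-mono : ∀ (xs : List A) {f g : A → ℕ} → (∀ {x} → x ∈ xs → f x ≤ g x) → ∑ xs f ≤ ∑ xs g
∑-mono []       f≤g = z≤n
∑-mono (x ∷ xs) f≤g = +-mono-≤ (f≤g (here refl)) (∑-mono xs (f≤g ∘ there))

∑-cong : ∀ (xs : List A) {f g : A → ℕ} → (∀ x → f x ≡ g x) → ∑ xs f ≡ ∑ xs g
∑-cong []       f≡g = refl
∑-cong (x ∷ xs) f≡g = cong₂ _+_ (f≡g x) (∑-cong xs f≡g)

∑-+ : ∀ (xs : List A) (f g : A → ℕ) → ∑ xs (λ x → f x + g x) ≡ ∑ xs f + ∑ xs g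
∑-+ []       f g = refl
∑-+ (x ∷ xs) f g = trans (cong (f x + g x +_) (∑-+ xs f g)) (shuffle (f x) (g x) (∑ xs f) (∑ xs g))
  where
  shuffle : ∀ a b c d → a + b + (c + d) ≡ a + c + (b + d)
  shuffle = solve-∀

∑-* : ∀ (xs : List A) (f : A → ℕ) k → ∑ xs f * k ≡ ∑ xs (λ x → f x * k)
∑-* []       f k = refl
∑-* (x ∷ xs) f k = trans (*-distribʳ-+ k (f x) (∑ xs f)) (cong (f x * k +_) (∑-* xs f k))

∑-const : ∀ (xs : List A) k → ∑ xs (λ _ → k) ≡ length xs * k
∑-const []       k = refl
∑-const (x ∷ xs) k = cong (k +_) (∑-const xs k)

∑-≤ : ∀ (xs : List A) {f : A → ℕ} {k} → (∀ {x} → x ∈ xs → f x ≤ k) → ∑ xs f ≤ length xs * k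
∑-≤ xs {k = k} f≤k = ≤-trans (∑-mono xs f≤k) (≤-reflexive (∑-const xs k))

∑-swap : ∀ (xs : List A) (ys : List B) (f : A → B → ℕ) →
         ∑ xs (λ x → ∑ ys (f x)) ≡ ∑ ys (λ y → ∑ xs (λ x → f x y))
∑-swap []       ys f = sym (trans (∑-const ys 0) (*-zeroʳ (length ys)))
∑-swap (x ∷ xs) ys f = trans (cong (∑ ys (f x) +_) (∑-swap xs ys f)) (sym (∑-+ ys (f x) _))

∑-map : ∀ (g : A → B) xs f → ∑ (map g xs) f ≡ ∑ xs (f ∘ g)
∑-map g []       f = refl
∑-map g (x ∷ xs) f = cong (f (g x) +_) (∑-map g xs f)

∑-++ : ∀ (xs ys : List A) f → ∑ (xs ++ ys) f ≡ ∑ xs f + ∑ ys f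
∑-++ []       ys f = refl
∑-++ (x ∷ xs) ys f = trans (cong (f x +_) (∑-++ xs ys f)) (sym (+-assoc (f x) _ _))

∑-concatMap : ∀ (g : A → List B) xs f → ∑ (concatMap g xs) f ≡ ∑ xs (λ x → ∑ (g x) f)
∑-concatMap g []       f = refl
∑-concatMap g (x ∷ xs) f = trans (∑-++ (g x) _ f) (cong (∑ (g x) f +_) (∑-concatMap g xs f))

≤-∑ : ∀ {xs : List A} {x} (f : A → ℕ) → x ∈ xs → f x ≤ ∑ xs f
≤-∑ f (here refl) = m≤m+n _ _
≤-∑ f (there x∈)  = ≤-trans (≤-∑ f x∈) (m≤n+m _ _)

length≡∑ : ∀ (xs : List A) → length xs ≡ ∑ xs (λ _ → 1)
length≡∑ xs = sym (trans (∑-const xs 1) (*-identityʳ _))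

length-concatMap-≤ : ∀ (g : A → List B) xs {k} → (∀ {x} → x ∈ xs → length (g x) ≤ k) →
                     length (concatMap g xs) ≤ length xs * k
length-concatMap-≤ g []       h = z≤n
length-concatMap-≤ g (x ∷ xs) h =
  ≤-trans (≤-reflexive (length-++ (g x))) (+-mono-≤ (h (here refl)) (length-concatMap-≤ g xs (h ∘ there)))

∈-concatMap : ∀ (g : A → List B) {xs x y} → x ∈ xs → y ∈ g x → y ∈ concatMap g xs
∈-concatMap g x∈ y∈ = ∈-concatMap⁺ g (Any.map (λ { refl → y∈ }) x∈)

Unique-⊆-length : ∀ {xs ys : List A} → Unique xs → (∀ {x} → x ∈ xs → x ∈ ys) → length xs ≤ length ys
Unique-⊆-length {xs = []} u sub = z≤n
Unique-⊆-length {xs = x ∷ xs} (x≢ ∷ u) sub with ∈-∃++ (sub (here refl))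
... | ys , zs , refl = begin
  suc (length xs)            ≤⟨ s≤s (Unique-⊆-length u sub′) ⟩
  suc (length (ys ++ zs))    ≡⟨ cong suc (length-++ ys) ⟩
  suc (length ys + length zs) ≡⟨ sym (+-suc (length ys) (length zs)) ⟩
  length ys + suc (length zs) ≡⟨ sym (length-++ ys) ⟩
  length (ys ++ x ∷ zs)      ∎
  where
  open ≤-Reasoning
  sub′ : ∀ {z} → z ∈ xs → z ∈ ys ++ zs
  sub′ z∈ with ∈-++⁻ ys (sub (there z∈))
  ... | inj₁ p = ∈-++⁺ˡ p
  ... | inj₂ (here refl) = ⊥-elim (All.lookup x≢ z∈ refl)
  ... | inj₂ (there p) = ∈-++⁺ʳ ys p

vecs : List A → ∀ k → List (Vec A k)
vecs xs zero    = [] ∷ []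
vecs xs (suc k) = concatMap (λ a → map (a ∷_) (vecs xs k)) xs

∈-vecs : ∀ {xs : List A} → (∀ a → a ∈ xs) → ∀ {k} (v : Vec A k) → v ∈ vecs xs k
∈-vecs all []      = here refl
∈-vecs all (a ∷ v) = ∈-concatMap _ (all a) (∈-map⁺ (a ∷_) (∈-vecs all v))

∑-vecs : ∀ (xs : List A) k f → ∑ (vecs xs (suc k)) f ≡ ∑ xs (λ a → ∑ (vecs xs k) (f ∘ (a ∷_)))
∑-vecs xs k f = trans (∑-concatMap _ xs f) (∑-cong xs (λ a → ∑-map (a ∷_) (vecs xs k) f))

-- Indicator functions of arbitrary propositions

module Indicator (em : ExcludedMiddle 0ℓ) where

  𝟙 : Set → ℕ
  𝟙 P with em {P}
  ... | yes _ = 1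
  ... | no  _ = 0

  𝟙-yes : ∀ {P} → P → 𝟙 P ≡ 1
  𝟙-yes {P} p with em {P}
  ... | yes _ = refl
  ... | no ¬p = ⊥-elim (¬p p)

  𝟙-no : ∀ {P} → ¬ P → 𝟙 P ≡ 0
  𝟙-no {P} ¬p with em {P}
  ... | yes p = ⊥-elim (¬p p)
  ... | no _  = refl

  𝟙-mono : ∀ {P Q} → (P → Q) → 𝟙 P ≤ 𝟙 Q
  𝟙-mono {P} f with em {P}
  ... | yes p = ≤-reflexive (sym (𝟙-yes (f p)))
  ... | no _  = z≤n

  𝟙-cong : ∀ {P Q} → (P → Q) → (Q → P) → 𝟙 P ≡ 𝟙 Q
  𝟙-cong f g = ≤-antisym (𝟙-mono f) (𝟙-mono g)

  𝟙-× : ∀ {P Q : Set} → 𝟙 (P × Q) ≡ 𝟙 P * 𝟙 Q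
  𝟙-× {P} {Q} with em {P}
  ... | yes p = trans (𝟙-cong proj₂ (p ,_)) (sym (+-identityʳ _))
  ... | no ¬p = 𝟙-no (¬p ∘ proj₁)

  length-filter≡∑ : ∀ {P : A → Set} (P? : Decidable P) xs → length (filter P? xs) ≡ ∑ xs (𝟙 ∘ P)
  length-filter≡∑ P? [] = refl
  length-filter≡∑ P? (x ∷ xs) with P? x
  ... | yes p = cong₂ _+_ (sym (𝟙-yes p)) (length-filter≡∑ P? xs)
  ... | no ¬p = trans (length-filter≡∑ P? xs) (cong (_+ ∑ xs _) (sym (𝟙-no ¬p)))

  ∑-positive : ∀ (xs : List A) {P : A → Set} → 0 < ∑ xs (𝟙 ∘ P) → ∃[ x ] P x
  ∑-positive (x ∷ xs) {P} h with em {P x}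
  ... | yes p = x , p
  ... | no ¬p = ∑-positive xs h

-- Rosenfeld's counting argument

∈-minus⁻ : ∀ {n} (S : Subset n) {u w} → w ∈ₛ S - u → w ∈ₛ S × w ≢ u
∈-minus⁻ S {u} {w} w∈ = p─q⊆p S _ w∈ , λ { refl → ∉-self S w w∈ }
  where
  ∉-self : ∀ {n} (S : Subset n) u → ¬ u ∈ₛ S - u
  ∉-self (s ∷ S) zero ()
  ∉-self (s ∷ S) (suc u) (Vec.there p) = ∉-self S u p

removeAll : ∀ {n} → Subset n → List (Fin n) → Subset n
removeAll S []       = S
removeAll S (u ∷ us) = removeAll S us - u

removeAll-⊆ : ∀ {n} (S : Subset n) us → removeAll S us ⊆ S
removeAll-⊆ S []       = id
removeAll-⊆ S (u ∷ us) = removeAll-⊆ S us ∘ proj₁ ∘ ∈-minus⁻ (removeAll S us)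

∉-removeAll : ∀ {n} (S : Subset n) {us u} → u ∈ us → u ∉ₛ removeAll S us
∉-removeAll S {x ∷ us} (here refl) u∈ = proj₂ (∈-minus⁻ (removeAll S us) u∈) refl
∉-removeAll S {x ∷ us} (there p)   u∈ = ∉-removeAll S p (proj₁ (∈-minus⁻ (removeAll S us) u∈))

∈-removeAll : ∀ {n} (S : Subset n) {us u} → u ∈ₛ S → All (λ u′ → u ≢ u′) us → u ∈ₛ removeAll S us
∈-removeAll S u∈S []          = u∈S
∈-removeAll S u∈S (u≢ ∷ u≢us) = x∈p∧x≢y⇒x∈p-y (∈-removeAll S u∈S u≢us) u≢

module Resampling (em : ExcludedMiddle 0ℓ) where
  open Indicator em

  ∑-𝟙≡ : ∀ {xs : List A} {b} → Unique xs → b ∈ xs → ∑ xs (λ a → 𝟙 (a ≡ b)) ≡ 1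
  ∑-𝟙≡ {xs = x ∷ xs} (x≢ ∷ u) (here refl) =
    cong₂ _+_ (𝟙-yes refl) (n≤0⇒n≡0 (≤-trans
      (∑-≤ xs λ y∈ → ≤-reflexive (𝟙-no (All.lookup x≢ y∈ ∘ sym))) (≤-reflexive (*-zeroʳ (length xs)))))
  ∑-𝟙≡ {xs = x ∷ xs} (x≢ ∷ u) (there b∈) =
    cong₂ _+_ (𝟙-no (All.lookup x≢ b∈)) (∑-𝟙≡ u b∈)

  -- As f and g ignore the colour of u, the C recolourings of u share one value of f, and exactly
  -- one of them agrees with g. In probabilistic terms, a uniformly coloured u hits a prescribed
  -- colour with probability 1/C.
  resample : ∀ {n C} (u : Fin n) (f : Vec (Fin C) n → ℕ) (g : Vec (Fin C) n → Fin C) →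
             (∀ c a → f (c [ u ]≔ a) ≡ f c) → (∀ c a → g (c [ u ]≔ a) ≡ g c) →
             ∑ (vecs (allFin C) n) (λ c → f c * 𝟙 (lookup c u ≡ g c)) * C ≡ ∑ (vecs (allFin C) n) f
  resample {suc n} {zero} zero f g f-inv g-inv = refl
  resample {suc n} {suc k} zero f g f-inv g-inv = begin
    ∑ (vecs Cs (suc n)) (λ c → f c * 𝟙 (lookup c zero ≡ g c)) * suc k
      ≡⟨ cong (_* suc k) (∑-vecs Cs n _) ⟩
    ∑ Cs (λ a → ∑ (vecs Cs n) (λ c → f (a ∷ c) * 𝟙 (a ≡ g (a ∷ c)))) * suc k
      ≡⟨ cong (_* suc k) (∑-cong Cs λ a → ∑-cong (vecs Cs n) λ c →
           cong₂ (λ y z → y * 𝟙 (a ≡ z)) (f-inv (zero ∷ c) a) (g-inv (zero ∷ c) a)) ⟩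
    ∑ Cs (λ a → ∑ (vecs Cs n) (λ c → f (zero ∷ c) * 𝟙 (a ≡ g (zero ∷ c)))) * suc k
      ≡⟨ cong (_* suc k) (∑-swap Cs (vecs Cs n) _) ⟩
    ∑ (vecs Cs n) (λ c → ∑ Cs (λ a → f (zero ∷ c) * 𝟙 (a ≡ g (zero ∷ c)))) * suc k
      ≡⟨ cong (_* suc k) (∑-cong (vecs Cs n) λ c → begin
           ∑ Cs (λ a → f (zero ∷ c) * 𝟙 (a ≡ g (zero ∷ c))) ≡⟨ ∑-cong Cs (λ a → *-comm (f (zero ∷ c)) _) ⟩
           ∑ Cs (λ a → 𝟙 (a ≡ g (zero ∷ c)) * f (zero ∷ c)) ≡⟨ sym (∑-* Cs (λ a → 𝟙 (a ≡ g (zero ∷ c))) (f (zero ∷ c))) ⟩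
           ∑ Cs (λ a → 𝟙 (a ≡ g (zero ∷ c))) * f (zero ∷ c)
             ≡⟨ cong (_* f (zero ∷ c)) (∑-𝟙≡ (Unique.allFin⁺ (suc k)) (∈-allFin (g (zero ∷ c)))) ⟩
           1 * f (zero ∷ c)                                 ≡⟨ *-identityˡ _ ⟩
           f (zero ∷ c)                                     ∎) ⟩
    ∑ (vecs Cs n) (λ c → f (zero ∷ c)) * suc k
      ≡⟨ *-comm _ (suc k) ⟩
    suc k * ∑ (vecs Cs n) (λ c → f (zero ∷ c))
      ≡⟨ cong (_* ∑ (vecs Cs n) (λ c → f (zero ∷ c))) (sym (length-tabulate {n = suc k} id)) ⟩
    length Cs * ∑ (vecs Cs n) (λ c → f (zero ∷ c))
      ≡⟨ sym (∑-const Cs _) ⟩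
    ∑ Cs (λ a → ∑ (vecs Cs n) (λ c → f (zero ∷ c)))
      ≡⟨ ∑-cong Cs (λ a → ∑-cong (vecs Cs n) λ c → sym (f-inv (zero ∷ c) a)) ⟩
    ∑ Cs (λ a → ∑ (vecs Cs n) (λ c → f (a ∷ c)))
      ≡⟨ sym (∑-vecs Cs n f) ⟩
    ∑ (vecs Cs (suc n)) f ∎
    where
    open ≡-Reasoning
    Cs = allFin (suc k)
  resample {suc n} {C} (suc u) f g f-inv g-inv = begin
    ∑ (vecs Cs (suc n)) (λ c → f c * 𝟙 (lookup c (suc u) ≡ g c)) * C
      ≡⟨ cong (_* C) (∑-vecs Cs n _) ⟩
    ∑ Cs (λ a → ∑ (vecs Cs n) (λ c → f (a ∷ c) * 𝟙 (lookup c u ≡ g (a ∷ c)))) * C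
      ≡⟨ ∑-* Cs _ C ⟩
    ∑ Cs (λ a → ∑ (vecs Cs n) (λ c → f (a ∷ c) * 𝟙 (lookup c u ≡ g (a ∷ c))) * C)
      ≡⟨ ∑-cong Cs (λ a → resample u (f ∘ (a ∷_)) (g ∘ (a ∷_)) (λ c b → f-inv (a ∷ c) b) (λ c b → g-inv (a ∷ c) b)) ⟩
    ∑ Cs (λ a → ∑ (vecs Cs n) (λ c → f (a ∷ c)))
      ≡⟨ sym (∑-vecs Cs n f) ⟩
    ∑ (vecs Cs (suc n)) f ∎
    where
    open ≡-Reasoning
    Cs = allFin C

-- A pair (u , w) says that u is coloured like w: the colour of u is determined by the others, as
-- Rosenfeld's argument requires.
Event : ℕ → Set
Event n = List (Fin n × Fin n)

Forced : ∀ {n C} → Vec (Fin C) n → Event n → Set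
Forced c = All (λ (u , w) → lookup c u ≡ lookup c w)

-- The first components can be recoloured one after the other, from the end of
-- the list, without disturbing the equalities that come later in the list.
Independent : ∀ {n} → Event n → Set
Independent e = All (λ (u , w) → u ≢ w) e × AllPairs (λ (u , _) (u′ , w′) → u ≢ u′ × u ≢ w′) e

-- The head determines the colour of the new vertex v. Only the vertices of `rest` belong to the set
-- coloured so far, so r, and not the length of e, is the exponent in the weight β^(-r).
record EventAt {n} (S : Subset n) (v : Fin n) (r : ℕ) (e : Event n) : Set where
  field
    representative : Fin n
    rest           : Event n
    shape          : e ≡ (v , representative) ∷ rest
    rest-length    : length rest ≡ r
    rest-∈         : All (λ p → proj₁ p ∈ₛ S) rest
    independent    : Independent e

-- D is a common denominator for the weights of the groups.
record Group {n} (β D : ℕ) (S : Subset n) (v : Fin n) : Set where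
  field
    exponent weight : ℕ
    events          : List (Event n)
    events-at       : ∀ {e} → e ∈ events → EventAt S v exponent e
    few             : D * length events ≤ weight * β ^ exponent

module Counting (em : ExcludedMiddle 0ℓ) {n C β D : ℕ} .{{_ : NonZero C}} .{{_ : NonZero β}} .{{_ : NonZero D}}
  (Valid : Subset n → Vec (Fin C) n → Set)
  (antitone : ∀ {S R c} → S ⊆ R → Valid R c → Valid S c)
  (local : ∀ {S c c′} → (∀ {u} → u ∈ₛ S → lookup c u ≡ lookup c′ u) → Valid S c → Valid S c′)
  where
  open Indicator em
  open Resampling em

  private
    colorings : List (Vec (Fin C) n)
    colorings = vecs (allFin C) n

  -- All vertices are coloured, but only S is constrained; each vertex outside S contributes a free
  -- factor C. Rosenfeld's claim that v multiplies the number of colourings of S - v by at least β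
  -- therefore takes the form `β * W (S - v) ≤ C * W S`.
  W : Subset n → ℕ
  W S = ∑ colorings (𝟙 ∘ Valid S)

  -- Validity on R does not see the first components, so each equality divides the count by exactly
  -- C.
  W-forced : ∀ {R} e → Independent e → (∀ {p} → p ∈ e → proj₁ p ∉ₛ R) →
             ∑ colorings (λ c → 𝟙 (Valid R c × Forced c e)) * C ^ length e ≡ W R
  W-forced {R} [] _ _ = trans (*-identityʳ _) (∑-cong colorings λ c → 𝟙-cong proj₁ (_, []))
  W-forced {R} ((u , w) ∷ e) (u≢w ∷ irr , u≢ ∷ ind) e∉R = begin
    ∑ colorings (λ c → 𝟙 (Valid R c × Forced c ((u , w) ∷ e))) * (C * C ^ length e)
      ≡⟨ cong (_* (C * C ^ length e)) (∑-cong colorings λ c → trans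
           (𝟙-cong (λ { (v , p ∷ ps) → (v , ps) , p }) (λ { ((v , ps) , p) → v , p ∷ ps })) 𝟙-×) ⟩
    ∑ colorings (λ c → f c * 𝟙 (lookup c u ≡ lookup c w)) * (C * C ^ length e)
      ≡⟨ sym (*-assoc (∑ colorings (λ c → f c * 𝟙 (lookup c u ≡ lookup c w))) C (C ^ length e)) ⟩
    ∑ colorings (λ c → f c * 𝟙 (lookup c u ≡ lookup c w)) * C * C ^ length e
      ≡⟨ cong (_* C ^ length e) (resample u f (λ c → lookup c w) f-inv λ c a → lookup∘update′ (u≢w ∘ sym) c a) ⟩
    ∑ colorings f * C ^ length e
      ≡⟨ W-forced e (irr , ind) (e∉R ∘ there) ⟩
    W R ∎
    where
    open ≡-Reasoning
    f : Vec (Fin C) n → ℕ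
    f c = 𝟙 (Valid R c × Forced c e)
    agree : ∀ c a {x} → u ≢ x → lookup (c [ u ]≔ a) x ≡ lookup c x
    agree c a u≢x = lookup∘update′ (u≢x ∘ sym) c a
    agreeT : ∀ c a {x} → x ∈ₛ R → lookup (c [ u ]≔ a) x ≡ lookup c x
    agreeT c a x∈ = agree c a λ { refl → e∉R (here refl) x∈ }
    f-inv : ∀ c a → f (c [ u ]≔ a) ≡ f c
    f-inv c a = 𝟙-cong
      (λ (v , fs) → local (agreeT c a) v ,
        All.zipWith (λ ((p , q) , eq) → trans (sym (agree c a p)) (trans eq (agree c a q))) (u≢ , fs))
      (λ (v , fs) → local (sym ∘ agreeT c a) v ,
        All.zipWith (λ ((p , q) , eq) → trans (agree c a p) (trans eq (sym (agree c a q)))) (u≢ , fs))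

  -- The vertices are put back one at a time, and each time at least the fraction β/C of the
  -- colourings survives.
  telescope : ∀ S → (∀ R u → R ⊆ S → u ∈ₛ R → β * W (R - u) ≤ C * W R) →
              ∀ us → Unique us → All (_∈ₛ S) us → β ^ length us * W (removeAll S us) ≤ C ^ length us * W S
  telescope S ih [] _ _ = ≤-refl
  telescope S ih (u ∷ us) (u≢ ∷ uniq) (u∈ ∷ us∈) = begin
    β * β ^ k * W (R - u)   ≡⟨ swap₁ β (β ^ k) (W (R - u)) ⟩
    β ^ k * (β * W (R - u)) ≤⟨ *-monoʳ-≤ (β ^ k) (ih R u (removeAll-⊆ S us) (∈-removeAll S u∈ u≢)) ⟩
    β ^ k * (C * W R)       ≡⟨ swap₂ (β ^ k) C (W R) ⟩
    C * (β ^ k * W R)       ≤⟨ *-monoʳ-≤ C (telescope S ih us uniq us∈) ⟩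
    C * (C ^ k * W S)       ≡⟨ sym (*-assoc C (C ^ k) (W S)) ⟩
    C * C ^ k * W S         ∎
    where
    open ≤-Reasoning
    k = length us
    R = removeAll S us
    swap₁ : ∀ a b c → a * b * c ≡ b * (a * c)
    swap₁ = solve-∀
    swap₂ : ∀ a b c → a * (b * c) ≡ b * (a * c)
    swap₂ = solve-∀

  -- Forgetting the constraints at the r recoloured vertices of S makes the count of forced
  -- colourings exact. The induction hypothesis then compares the smaller set with S at the price
  -- (C/β)^r, and C^r cancels against the r forced equalities.
  forced-bound : ∀ S v {r e} → v ∉ₛ S → (∀ R u → R ⊆ S → u ∈ₛ R → β * W (R - u) ≤ C * W R) →
                 EventAt S v r e → β ^ r * (C * ∑ colorings (λ c → 𝟙 (Valid S c × Forced c e))) ≤ W S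
  forced-bound S v {r} {e} v∉S ih record { representative = w ; rest = rest ; shape = refl ; rest-length = refl
                               ; rest-∈ = rest-∈ ; independent = independent } =
    *-cancelˡ-≤ (C ^ r) {{m^n≢0 C r}} (begin
      C ^ r * (β ^ r * (C * X))   ≡⟨ shuffle (C ^ r) (β ^ r) C X ⟩
      β ^ r * (X * (C * C ^ r))   ≤⟨ *-monoʳ-≤ (β ^ r) (*-monoˡ-≤ (C * C ^ r) (∑-mono colorings λ _ →
                                       𝟙-mono λ (val , f) → antitone (removeAll-⊆ S us) val , f)) ⟩
      β ^ r * (Y * (C * C ^ r))   ≡⟨ cong (β ^ r *_) (W-forced e independent avoid) ⟩
      β ^ r * W R                 ≤⟨ subst (λ k → β ^ k * W R ≤ C ^ k * W S) (length-map proj₁ rest)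
                                       (telescope S ih us uniq (All.map⁺ rest-∈)) ⟩
      C ^ r * W S                 ∎)
    where
    open ≤-Reasoning
    us = map proj₁ rest
    R = removeAll S us
    X = ∑ colorings (λ c → 𝟙 (Valid S c × Forced c e))
    Y = ∑ colorings (λ c → 𝟙 (Valid R c × Forced c e))
    uniq : Unique us
    uniq with proj₂ independent
    ... | _ ∷ ps = AllPairs.map⁺ (AllPairs.map proj₁ ps)
    avoid : ∀ {p} → p ∈ e → proj₁ p ∉ₛ R
    avoid (here refl) = v∉S ∘ removeAll-⊆ S us
    avoid (there p∈)  = ∉-removeAll S (∈-map⁺ proj₁ p∈)
    shuffle : ∀ a b c d → a * (b * (c * d)) ≡ b * (d * (c * a))
    shuffle = solve-∀

  group-bound : ∀ S v → v ∉ₛ S → (∀ R u → R ⊆ S → u ∈ₛ R → β * W (R - u) ≤ C * W R) → (g : Group β D S v) →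
                D * C * ∑ (Group.events g) (λ e → ∑ colorings (λ c → 𝟙 (Valid S c × Forced c e))) ≤ Group.weight g * W S
  group-bound S v v∉S ih g = *-cancelˡ-≤ (β ^ r) {{m^n≢0 β r}} (begin
    β ^ r * (D * C * ∑ events X)             ≡⟨ shuffle (β ^ r) D C (∑ events X) ⟩
    D * (∑ events X * (β ^ r * C))           ≡⟨ cong (D *_) (∑-* events X (β ^ r * C)) ⟩
    D * ∑ events (λ e → X e * (β ^ r * C))   ≤⟨ *-monoʳ-≤ D (∑-≤ events λ {e} e∈ →
                                                 ≤-trans (≤-reflexive (shuffle′ (X e) (β ^ r) C)) (forced-bound S v v∉S ih (events-at e∈))) ⟩
    D * (length events * W S)                ≡⟨ sym (*-assoc D _ _) ⟩
    D * length events * W S                  ≤⟨ *-monoˡ-≤ (W S) few ⟩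
    weight * β ^ r * W S                     ≡⟨ shuffle″ weight (β ^ r) (W S) ⟩
    β ^ r * (weight * W S)                   ∎)
    where
    open ≤-Reasoning
    open Group g renaming (exponent to r)
    X = λ e → ∑ colorings (λ c → 𝟙 (Valid S c × Forced c e))
    shuffle : ∀ a b c d → a * (b * c * d) ≡ b * (d * (a * c))
    shuffle = solve-∀
    shuffle′ : ∀ a b c → a * (b * c) ≡ b * (c * a)
    shuffle′ = solve-∀
    shuffle″ : ∀ a b c → a * b * c ≡ b * (a * c)
    shuffle″ = solve-∀

  module Extend
    (groups : ∀ S v → v ∈ₛ S → List (Group β D (S - v) v))
    (light : ∀ S v (v∈S : v ∈ₛ S) → ∑ (groups S v v∈S) Group.weight + D * β ≤ D * C)
    (cover : ∀ S v (v∈S : v ∈ₛ S) c → Valid (S - v) c → ¬ Valid S c →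
             ∃[ g ] (g ∈ groups S v v∈S × ∃[ e ] (e ∈ Group.events g × Forced c e)))
    where

    -- A colouring valid on S - v fails on S only if a listed event is forced. By the union bound
    -- this loses at most the fraction (total weight)/(D C) of the colourings, and `light` leaves at
    -- least β/C.
    W-extend : ∀ S → Acc _⊂_ S → ∀ v → v ∈ₛ S → β * W (S - v) ≤ C * W S
    W-extend S (acc rec) v v∈S = *-cancelˡ-≤ D (+-cancelˡ-≤ (∑ gs weight * W S′) _ _ (begin
      ∑ gs weight * W S′ + D * (β * W S′)    ≡⟨ shuffle (∑ gs weight) (W S′) D β ⟩
      (∑ gs weight + D * β) * W S′           ≤⟨ *-monoˡ-≤ (W S′) (light S v v∈S) ⟩
      D * C * W S′                           ≤⟨ *-monoʳ-≤ (D * C) union ⟩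
      D * C * (W S + ∑ gs Z)                 ≡⟨ *-distribˡ-+ (D * C) _ _ ⟩
      D * C * W S + D * C * ∑ gs Z           ≡⟨ cong (D * C * W S +_) (trans (*-comm (D * C) _) (∑-* gs Z (D * C))) ⟩
      D * C * W S + ∑ gs (λ g → Z g * (D * C)) ≤⟨ +-monoʳ-≤ (D * C * W S) (∑-mono gs λ {g} _ →
                                                 ≤-trans (≤-reflexive (*-comm (Z g) (D * C))) (group-bound S′ v v∉S′ ih g)) ⟩
      D * C * W S + ∑ gs (λ g → weight g * W S′) ≡⟨ cong (D * C * W S +_) (sym (∑-* gs weight (W S′))) ⟩
      D * C * W S + ∑ gs weight * W S′       ≡⟨ shuffle′ D C (W S) (∑ gs weight * W S′) ⟩
      ∑ gs weight * W S′ + D * (C * W S)     ∎))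
      where
      open ≤-Reasoning
      open Group
      gs = groups S v v∈S
      S′ = S - v
      Z : Group β D S′ v → ℕ
      Z g = ∑ (events g) (λ e → ∑ colorings (λ c → 𝟙 (Valid S′ c × Forced c e)))
      v∉S′ : v ∉ₛ S′
      v∉S′ v∈ = proj₂ (∈-minus⁻ S v∈) refl
      -- Every set that `telescope` passes through is a subset of S - v, hence a proper subset of S.
      ih : ∀ R u → R ⊆ S′ → u ∈ₛ R → β * W (R - u) ≤ C * W R
      ih R u R⊆ u∈ = W-extend R (rec (⊆-⊂-trans R⊆ (x∈p⇒p-x⊂p v∈S))) u u∈
      pointwise : ∀ c → 𝟙 (Valid S′ c) ≤ 𝟙 (Valid S c) + ∑ gs (λ g → ∑ (events g) (λ e → 𝟙 (Valid S′ c × Forced c e)))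
      pointwise c with em {Valid S c} | em {Valid S′ c}
      ... | _      | no _  = z≤n
      ... | yes _  | yes _ = s≤s z≤n
      ... | no inv | yes val with cover S v v∈S c val inv
      ...   | g , g∈ , e , e∈ , forced = begin
        1 ≡⟨ sym (𝟙-yes (val , forced)) ⟩
        𝟙 (Valid S′ c × Forced c e) ≤⟨ ≤-∑ (λ e → 𝟙 (Valid S′ c × Forced c e)) e∈ ⟩
        ∑ (events g) (λ e → 𝟙 (Valid S′ c × Forced c e)) ≤⟨ ≤-∑ (λ g → ∑ (events g) (λ e → 𝟙 (Valid S′ c × Forced c e))) g∈ ⟩
        ∑ gs (λ g → ∑ (events g) (λ e → 𝟙 (Valid S′ c × Forced c e))) ∎
      union : W S′ ≤ W S + ∑ gs Z
      union = begin
        W S′ ≤⟨ ∑-mono colorings (λ {c} _ → pointwise c) ⟩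
        ∑ colorings (λ c → 𝟙 (Valid S c) + ∑ gs (λ g → ∑ (events g) (λ e → 𝟙 (Valid S′ c × Forced c e))))
          ≡⟨ ∑-+ colorings _ _ ⟩
        W S + ∑ colorings (λ c → ∑ gs (λ g → ∑ (events g) (λ e → 𝟙 (Valid S′ c × Forced c e))))
          ≡⟨ cong (W S +_) (trans (∑-swap colorings gs _) (∑-cong gs λ g → ∑-swap colorings (events g) _)) ⟩
        W S + ∑ gs Z ∎
      shuffle : ∀ a b c d → a * b + c * (d * b) ≡ (a + c * d) * b
      shuffle = solve-∀
      shuffle′ : ∀ a b c d → a * b * c + d ≡ d + a * (b * c)
      shuffle′ = solve-∀

    W-positive : (∀ c → Valid ⊥ c) → ∀ S → Acc _⊂_ S → 0 < W S
    W-positive valid∅ S a@(acc rec) with em {∃[ u ] u ∈ₛ S}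
    ... | yes (u , u∈S) = *-cancelˡ-< C 0 (W S) (subst (_< C * W S) (sym (*-zeroʳ C))
            (<-≤-trans (*-mono-< (>-nonZero⁻¹ β) (W-positive valid∅ (S - u) (rec (x∈p⇒p-x⊂p u∈S)))) (W-extend S a u u∈S)))
    ... | no empty = <-≤-trans (≤-reflexive (sym (𝟙-yes (antitone (λ u∈ → ⊥-elim (empty (_ , u∈))) (valid∅ c₀)))))
            (≤-∑ (𝟙 ∘ Valid S) (∈-vecs (λ a → ∈-allFin a) c₀))
      where
      someColor : ∀ k .{{_ : NonZero k}} → Fin k
      someColor (suc k) = zero
      c₀ = Vec.replicate n (someColor C)

    coloring-exists : (∀ c → Valid ⊥ c) → ∃[ c ] Valid ⊤ c
    coloring-exists valid∅ = ∑-positive colorings (W-positive valid∅ ⊤ (⊂-wellFounded ⊤))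

-- Patterns in graphs

length-allFin : ∀ n → length (allFin n) ≡ n
length-allFin n = length-tabulate {n = n} id

length-vecs : ∀ (xs : List A) k → length (vecs xs k) ≡ length xs ^ k
length-vecs xs zero    = refl
length-vecs xs (suc k) = begin
  length (vecs xs (suc k))                 ≡⟨ length≡∑ (vecs xs (suc k)) ⟩
  ∑ (vecs xs (suc k)) (λ _ → 1)            ≡⟨ ∑-vecs xs k _ ⟩
  ∑ xs (λ _ → ∑ (vecs xs k) (λ _ → 1))     ≡⟨ ∑-const xs _ ⟩
  length xs * ∑ (vecs xs k) (λ _ → 1)      ≡⟨ cong (length xs *_) (sym (length≡∑ (vecs xs k))) ⟩
  length xs * length (vecs xs k)           ≡⟨ cong (length xs *_) (length-vecs xs k) ⟩
  length xs ^ suc k                        ∎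
  where open ≡-Reasoning

Adj-sym : ∀ G {u v} → Adj G u v → Adj G v u
Adj-sym G {u} {v} = subst T (symm G u v)

Adj-irrefl : ∀ G {u} → ¬ Adj G u u
Adj-irrefl G {u} a = subst T (irrefl G u) a

Adj-≢ : ∀ G {u v} → Adj G u v → u ≢ v
Adj-≢ G a refl = Adj-irrefl G a

module _ (G : Graph) where

  private
    edges : List (Vertex G × Vertex G)
    edges = filter (λ (u , v) → (u <?ᶠ v) ×-dec T? (adj G u v))
                   (cartesianProduct (allFin (order G)) (allFin (order G)))

    edges-unique : Unique edges
    edges-unique = Unique.filter⁺ _ (Unique.cartesianProduct⁺ (Unique.allFin⁺ _) (Unique.allFin⁺ _))

    ordered : Vertex G × Vertex G → Vertex G × Vertex G
    ordered (u , v) with u <?ᶠ v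
    ... | yes _ = u , v
    ... | no  _ = v , u

  size-≤ : ∀ E → (∀ {u v} → Adj G u v → (u , v) ∈ E ⊎ (v , u) ∈ E) → size G ≤ length E
  size-≤ E cov = subst (size G ≤_) (length-map ordered E) (Unique-⊆-length edges-unique sub)
    where
    sub : ∀ {p} → p ∈ edges → p ∈ map ordered E
    sub {u , v} p∈ with ∈-filter⁻ (λ (u , v) → (u <?ᶠ v) ×-dec T? (adj G u v)) {xs = cartesianProduct (allFin (order G)) (allFin (order G))} p∈
    ... | _ , u<v , a with cov a
    ... | inj₁ q = subst (_∈ map ordered E) eq (∈-map⁺ ordered q)
      where
      eq : ordered (u , v) ≡ (u , v)
      eq with u <?ᶠ v
      ... | yes _ = refl
      ... | no u≮v = ⊥-elim (u≮v u<v)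
    ... | inj₂ q = subst (_∈ map ordered E) eq (∈-map⁺ ordered q)
      where
      eq : ordered (v , u) ≡ (u , v)
      eq with v <?ᶠ u
      ... | yes v<u = ⊥-elim (<-asym u<v v<u)
      ... | no _ = refl

  ≤-size : ∀ E → Unique E → (∀ {u v} → (u , v) ∈ E → u Fin.< v × Adj G u v) → length E ≤ size G
  ≤-size E uniq h = Unique-⊆-length uniq λ p∈ →
    ∈-filter⁺ _ (∈-cartesianProduct⁺ (∈-allFin _) (∈-allFin _)) (h p∈)

-- In `extend b bs P` a new vertex is attached to the vertices b ∷ bs; it gets the
-- index zero, and the indices of all earlier vertices go up by one.
data Pattern (k : ℕ) : Set where
  done   : Pattern k
  extend : Fin k → List (Fin k) → Pattern (suc k) → Pattern k

steps : ∀ {k} → Pattern k → ℕ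
steps done           = 0
steps (extend _ _ P) = suc (steps P)

backDegree : ∀ {k} → Pattern k → ℕ
backDegree done            = 0
backDegree (extend _ bs P) = suc (length bs) + backDegree P

steps≤backDegree : ∀ {k} (P : Pattern k) → steps P ≤ backDegree P
steps≤backDegree done            = z≤n
steps≤backDegree (extend _ bs P) = s≤s (≤-trans (steps≤backDegree P) (m≤n+m _ (length bs)))

-- K changes when a pattern is transported: it is found in a member of F without restriction, and
-- carried by the copy into G, where K says that a vertex has one of two given colours. The
-- attaching vertices must be distinct because they are to be compared with special sets.
Realizes : ∀ G (K : Vertex G → Set) {k} → Vec (Vertex G) k → Pattern k → Set
Realizes G K ctx done            = Unit
Realizes G K ctx (extend b bs P) =
  Σ[ w ∈ Vertex G ] (K w × (∀ i → lookup ctx i ≢ w) × Unique (map (lookup ctx) (b ∷ bs))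
    × All (λ i → Adj G (lookup ctx i) w) (b ∷ bs) × Realizes G K (w ∷ ctx) P)

-- In a connected graph this fails only if every edge contains h; then there is no path h - y - x
-- from which a pattern could grow.
NonStar : ∀ G → Vertex G → Set
NonStar G h = ∃[ y ] ∃[ x ] (Adj G h y × Adj G y x × x ≢ h)

-- Every pattern starts with a path h – y – x: its ends get the same colour, so
-- x and y represent the two colours of the pattern once h is recoloured.
RealizedAt : ∀ G (K : Vertex G → Set) → Vertex G → Pattern 3 → Set
RealizedAt G K h P =
  ∃[ y ] ∃[ x ] (K y × K x × Adj G h y × Adj G y x × x ≢ h × Realizes G K (x ∷ y ∷ h ∷ []) P)

Anywhere : ∀ {G} → Vertex G → Set
Anywhere _ = Unit

module _ (G H : Graph) (f : Vertex G → Vertex H) (f-inj : Injective _≡_ _≡_ f)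
         (f-hom : ∀ {u v} → Adj G u v → Adj H (f u) (f v)) where

  Realizes-map : ∀ {K K′} → (∀ {u} → K u → K′ (f u)) →
                 ∀ {k} {ctx : Vec (Vertex G) k} P → Realizes G K ctx P → Realizes H K′ (Vec.map f ctx) P
  Realizes-map K⇒K′ done _ = tt
  Realizes-map K⇒K′ {ctx = ctx} (extend b bs P) (w , Kw , fresh , uniq , adjs , rest) =
    f w , K⇒K′ Kw , (λ i eq → fresh i (f-inj (trans (sym (lookup-map i f ctx)) eq)))
        , subst Unique (trans (sym (map-∘ (b ∷ bs))) (map-cong′ (b ∷ bs))) (Unique.map⁺ f-inj uniq)
        , All.map (λ {i} a → subst (λ z → Adj H z (f w)) (sym (lookup-map i f ctx)) (f-hom a)) adjs
        , Realizes-map K⇒K′ P rest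
    where
    map-cong′ : ∀ is → map (f ∘ lookup ctx) is ≡ map (lookup (Vec.map f ctx)) is
    map-cong′ []       = refl
    map-cong′ (i ∷ is) = cong₂ _∷_ (sym (lookup-map i f ctx)) (map-cong′ is)

  NonStar-map : ∀ {h} → NonStar G h → NonStar H (f h)
  NonStar-map (y , x , hy , yx , x≢h) = f y , f x , f-hom hy , f-hom yx , x≢h ∘ f-inj

  RealizedAt-map : ∀ {K K′} → (∀ {u} → K u → K′ (f u)) → ∀ {h} P → RealizedAt G K h P → RealizedAt H K′ (f h) P
  RealizedAt-map K⇒K′ P (y , x , Ky , Kx , hy , yx , x≢h , r) =
    f y , f x , K⇒K′ Ky , K⇒K′ Kx , f-hom hy , f-hom yx , x≢h ∘ f-inj , Realizes-map K⇒K′ P r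

-- Finite lists of patterns

listsOf : List A → ℕ → List (List A)
listsOf xs k = map Vec.toList (vecs xs k)

listsUpTo : List A → ℕ → List (List A)
listsUpTo xs n = concatMap (listsOf xs) (upTo (suc n))

∈-listsUpTo : ∀ {xs : List A} → (∀ a → a ∈ xs) → ∀ {n} ys → length ys ≤ n → ys ∈ listsUpTo xs n
∈-listsUpTo {xs = xs} all ys len = ∈-concatMap (listsOf xs) (∈-upTo⁺ (s≤s len))
  (subst (_∈ listsOf xs (length ys)) (toList∘fromList ys) (∈-map⁺ Vec.toList (∈-vecs all (Vec.fromList ys))))

-- Listing too much is harmless: the length depends only on k, d and r, so it is a constant that the
-- error term absorbs.
patterns : ∀ {k} → ℕ → ℕ → List (Pattern k)
patterns     d zero    = done ∷ []
patterns {k} d (suc r) = done ∷ concatMap (λ b → concatMap (λ bs → map (extend b bs) (patterns d r)) (listsUpTo (allFin k) d)) (allFin k)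

∈-patterns : ∀ {k d r} (P : Pattern k) → backDegree P ≤ d → steps P ≤ r → P ∈ patterns d r
∈-patterns {r = zero} done _ _ = here refl
∈-patterns {r = suc r} done _ _ = here refl
∈-patterns {r = suc r} (extend b bs P) deg (s≤s st) = there
  (∈-concatMap _ (∈-allFin b) (∈-concatMap _ (∈-listsUpTo ∈-allFin bs (≤-trans (n≤1+n _) (≤-trans (m≤m+n _ _) deg)))
    (∈-map⁺ (extend b bs) (∈-patterns P (≤-trans (m≤n+m _ (suc (length bs))) deg) st))))

-- The bits drive a breadth-first search from the vertex p: `true` attaches a new
-- child to p, `false` moves on to the next vertex in the queue.  The newest
-- vertex has index zero, so the search proceeds towards smaller indices.
previous : ∀ {k} → Fin k → Fin k
previous zero    = zero
previous (suc i) = inject₁ i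

treePattern : ∀ (a : ℕ) {k L} → Fin k → Vec Bool L → Pattern k
treePattern zero    p bits           = done
-- A word that ends too early is completed by further children of p. Every word thus yields exactly
-- a steps, and all trees get the same weight.
treePattern (suc a) p []             = extend p [] (treePattern a (suc p) [])
treePattern (suc a) p (true ∷ bits)  = extend p [] (treePattern a (suc p) bits)
treePattern (suc a) p (false ∷ bits) = treePattern (suc a) (previous p) bits

steps-treePattern : ∀ (a : ℕ) {k L} (p : Fin k) (bits : Vec Bool L) → steps (treePattern a p bits) ≡ a
steps-treePattern zero    p bits           = refl
steps-treePattern (suc a) p []             = cong suc (steps-treePattern a (suc p) [])
steps-treePattern (suc a) p (true ∷ bits)  = cong suc (steps-treePattern a (suc p) bits)
steps-treePattern (suc a) p (false ∷ bits) = steps-treePattern (suc a) (previous p) bits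

backDegree-treePattern : ∀ (a : ℕ) {k L} (p : Fin k) (bits : Vec Bool L) → backDegree (treePattern a p bits) ≡ a
backDegree-treePattern zero    p bits           = refl
backDegree-treePattern (suc a) p []             = cong suc (backDegree-treePattern a (suc p) [])
backDegree-treePattern (suc a) p (true ∷ bits)  = cong suc (backDegree-treePattern a (suc p) bits)
backDegree-treePattern (suc a) p (false ∷ bits) = backDegree-treePattern (suc a) (previous p) bits

-- Finding patterns in a connected graph

module Exploration (em : ExcludedMiddle 0ℓ) (H : Graph) (connected : Connected H) where

  boundary : ∀ (P : Vertex H → Set) {r z} → P r → ¬ P z → ∃[ p ] ∃[ w ] (P p × ¬ P w × Adj H p w)
  boundary P {r} {z} = go (connected r z)
    where
    go : ∀ {r z} → Star (Adj H) r z → P r → ¬ P z → ∃[ p ] ∃[ w ] (P p × ¬ P w × Adj H p w)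
    go ε Pr ¬Pz = ⊥-elim (¬Pz Pr)
    go {r} (_◅_ {j = j} a as) Pr ¬Pz with em {P j}
    ... | yes Pj = go as Pj ¬Pz
    ... | no ¬Pj = r , j , Pr , ¬Pj , a

  private
    Distinct : ∀ {k} → Vec (Vertex H) k → Set
    Distinct ctx = ∀ {i j} → lookup ctx i ≡ lookup ctx j → i ≡ j

    Placed : ∀ {k} → Vec (Vertex H) k → Vertex H → Set
    Placed ctx w = ∃[ i ] lookup ctx i ≡ w

    Distinct-∷ : ∀ {k w} {ctx : Vec (Vertex H) k} → Distinct ctx → (∀ i → lookup ctx i ≢ w) → Distinct (w ∷ ctx)
    Distinct-∷ d fresh {zero}  {zero}  eq = refl
    Distinct-∷ d fresh {zero}  {suc j} eq = ⊥-elim (fresh j (sym eq))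
    Distinct-∷ d fresh {suc i} {zero}  eq = ⊥-elim (fresh i eq)
    Distinct-∷ d fresh {suc i} {suc j} eq = cong suc (d eq)

    path-distinct : ∀ {h y x} → Adj H h y → Adj H y x → x ≢ h → Distinct (x ∷ y ∷ h ∷ [])
    path-distinct hy yx x≢h =
      Distinct-∷ (Distinct-∷ (Distinct-∷ {ctx = []} (λ {i} → λ { {()} }) λ ()) (λ { zero → Adj-≢ H hy }))
                 (λ { zero → Adj-≢ H yx ; (suc zero) → x≢h ∘ sym })

  -- A tree grows from r, with one new edge for each new vertex, until it spans H. The inequality
  -- bounds the number of vertices that v can play in a member with exactly m edges.
  order≤1+size : order H ≤ suc (size H)
  order≤1+size with em {Vertex H}
  ... | no empty = ≤-trans (≤-reflexive (trans (sym (length-allFin (order H))) (none (allFin (order H))))) z≤n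
    where
    none : ∀ (xs : List (Vertex H)) → length xs ≡ 0
    none []      = refl
    none (x ∷ _) = ⊥-elim (empty x)
  ... | yes r = go (order H) (r ∷ []) [] ([] ∷ []) [] (here refl) (λ ()) refl (m≤m+n (order H) 1)
    where
    go : ∀ fuel us E → Unique us → Unique E → r ∈ us →
         (∀ {u v} → (u , v) ∈ E → u Fin.< v × Adj H u v × u ∈ us × v ∈ us) →
         length us ≡ suc (length E) → order H ≤ fuel + length us → order H ≤ suc (size H)
    go fuel us E uniq-us uniq-E r∈ E-ok len big with em {∃[ z ] z ∉ us}
    ... | no all = begin
      order H                   ≡⟨ sym (length-allFin (order H)) ⟩
      length (allFin (order H)) ≤⟨ Unique-⊆-length (Unique.allFin⁺ _) (λ {z} _ → decidable-stable em (λ z∉ → all (z , z∉))) ⟩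
      length us                 ≡⟨ len ⟩
      suc (length E)            ≤⟨ s≤s (≤-size H E uniq-E (λ p∈ → let a , b , _ = E-ok p∈ in a , b)) ⟩
      suc (size H)              ∎
      where open ≤-Reasoning
    ... | yes (z , z∉) with boundary (_∈ us) r∈ z∉
    go zero us E uniq-us uniq-E r∈ E-ok len big | yes (z , z∉) | p , w , p∈ , w∉ , a =
      ⊥-elim (<⇒≱ (≤-refl {suc (length us)}) (begin
        suc (length us) ≤⟨ Unique-⊆-length {ys = allFin (order H)} (All.¬Any⇒All¬ us w∉ ∷ uniq-us) (λ _ → ∈-allFin _) ⟩
        length (allFin (order H)) ≡⟨ length-allFin (order H) ⟩
        order H ≤⟨ big ⟩
        length us ∎))
      where open ≤-Reasoning
    go (suc fuel) us E uniq-us uniq-E r∈ E-ok len big | yes (z , z∉) | p , w , p∈ , w∉ , a =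
      go fuel (w ∷ us) (e ∷ E) (All.¬Any⇒All¬ us w∉ ∷ uniq-us) (All.¬Any⇒All¬ E e∉ ∷ uniq-E) (there r∈)
         E-ok′ (cong suc len) (≤-trans big (≤-reflexive (sym (+-suc fuel (length us)))))
      where
      new : ∃[ e ] ((proj₁ e Fin.< proj₂ e) × Adj H (proj₁ e) (proj₂ e) × proj₁ e ∈ w ∷ us × proj₂ e ∈ w ∷ us
                    × (proj₁ e ≡ w ⊎ proj₂ e ≡ w))
      new with p <?ᶠ w
      ... | yes p<w = (p , w) , p<w , a , there p∈ , here refl , inj₂ refl
      ... | no p≮w = (w , p) , ≤∧≢⇒< (≮⇒≥ p≮w) (Adj-≢ H a ∘ sym ∘ toℕ-injective) , Adj-sym H a , here refl , there p∈ , inj₁ refl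
      e = proj₁ new
      e∉ : e ∉ E
      e∉ e∈ with E-ok e∈ | proj₂ (proj₂ (proj₂ (proj₂ (proj₂ new))))
      ... | _ , _ , u∈ , v∈ | inj₁ eq = w∉ (subst (_∈ us) eq u∈)
      ... | _ , _ , u∈ , v∈ | inj₂ eq = w∉ (subst (_∈ us) eq v∈)
      E-ok′ : ∀ {u v} → (u , v) ∈ e ∷ E → u Fin.< v × Adj H u v × u ∈ w ∷ us × v ∈ w ∷ us
      E-ok′ (here refl) = let _ , a , b , c , d , _ = new in a , b , c , d
      E-ok′ (there q) = let a , b , c , d = E-ok q in a , b , there c , there d

  private
    -- A new vertex is attached to all its placed neighbours at once, so E always covers the edges
    -- among placed vertices. While E is shorter than `size H`, some vertex must therefore be
    -- missing, and connectedness supplies one next to a placed vertex.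
    explore : ∀ fuel {k} (ctx : Vec (Vertex H) k) → Distinct ctx → Fin k →
              ∀ E → (∀ i j → Adj H (lookup ctx i) (lookup ctx j) →
                       (lookup ctx i , lookup ctx j) ∈ E ⊎ (lookup ctx j , lookup ctx i) ∈ E) →
              ∀ t → t ≤ fuel → length E + t ≤ size H → ∃[ P ] (backDegree P ≡ t × Realizes H (Anywhere {H}) ctx P)
    explore fuel ctx d r E cov zero _ _ = done , refl , tt
    explore (suc fuel) {k} ctx d r E cov (suc t) (s≤s t≤fuel) small with em {∃[ z ] ¬ Placed ctx z}
    ... | no all = ⊥-elim (m+1+n≰m (length E) (≤-trans small
                     (size-≤ H E λ {u} {v} a → covered a (placed u) (placed v))))
      where
      placed : ∀ z → Placed ctx z
      placed z = decidable-stable em (λ ¬p → all (z , ¬p))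
      covered : ∀ {u v} → Adj H u v → Placed ctx u → Placed ctx v → (u , v) ∈ E ⊎ (v , u) ∈ E
      covered a (i , refl) (j , refl) = cov i j a
    ... | yes (z , ¬z) with boundary (Placed ctx) (r , refl) ¬z
    ...   | p , w , (ip , refl) , w∉ , a
          with filter (λ i → T? (adj H (lookup ctx i) w)) (allFin k) in eqB
             | Unique.filter⁺ (λ i → T? (adj H (lookup ctx i) w)) (Unique.allFin⁺ k)
    ...     | [] | _ = ⊥-elim (empty (subst (ip ∈_) eqB (∈-filter⁺ _ (∈-allFin ip) a)))
      where
      empty : ∀ {i : Fin k} → ¬ i ∈ []
      empty ()
    ...     | b ∷ bs | uniqB = finish (t ≤? length bs)
      where
      B? = λ i → T? (adj H (lookup ctx i) w)
      fresh : ∀ i → lookup ctx i ≢ w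
      fresh i eq = w∉ (i , eq)
      B-adj : All (λ i → Adj H (lookup ctx i) w) (b ∷ bs)
      B-adj = All.tabulate λ {i} i∈ → proj₂ (∈-filter⁻ B? {xs = allFin k} (subst (i ∈_) (sym eqB) i∈))
      finish : Dec (t ≤ length bs) → ∃[ P ] (backDegree P ≡ suc t × Realizes H (Anywhere {H}) ctx P)
      -- The edge budget ends at this vertex: only part of its edges is kept, which makes the back
      -- degree exactly `suc t`.
      finish (yes t≤) =
        extend b (take t bs) done , cong suc (trans (+-identityʳ _) (trans (length-take t bs) (m≤n⇒m⊓n≡m t≤)))
        , w , tt , fresh , Unique.map⁺ d (Unique.take⁺ (suc t) uniqB) , All.take⁺ (suc t) B-adj , tt
      finish (no t≰) with explore fuel (w ∷ ctx) (Distinct-∷ d fresh) zero E′ cov′ (t ∸ length bs)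
                            (≤-trans (m∸n≤m t (length bs)) t≤fuel) small′
        where
        E′ = map (λ i → lookup ctx i , w) (b ∷ bs) ++ E
        old : ∀ {i} → Adj H (lookup ctx i) w → (lookup ctx i , w) ∈ E′
        old {i} a = ∈-++⁺ˡ (∈-map⁺ (λ i → lookup ctx i , w) (subst (i ∈_) eqB (∈-filter⁺ B? (∈-allFin i) a)))
        keep : ∀ {e} → e ∈ E → e ∈ E′
        keep = ∈-++⁺ʳ (map (λ i → lookup ctx i , w) (b ∷ bs))
        cov′ : ∀ i j → Adj H (lookup (w ∷ ctx) i) (lookup (w ∷ ctx) j) →
               (lookup (w ∷ ctx) i , lookup (w ∷ ctx) j) ∈ E′ ⊎ (lookup (w ∷ ctx) j , lookup (w ∷ ctx) i) ∈ E′
        cov′ (zero) (zero)  a = ⊥-elim (Adj-irrefl H a)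
        cov′ (zero) (suc j) a = inj₂ (old (Adj-sym H a))
        cov′ (suc i) (zero)  a = inj₁ (old a)
        cov′ (suc i) (suc j) a with cov i j a
        ... | inj₁ q = inj₁ (keep q)
        ... | inj₂ q = inj₂ (keep q)
        small′ : length E′ + (t ∸ length bs) ≤ size H
        small′ = begin
          length E′ + (t ∸ length bs)
            ≡⟨ cong (_+ (t ∸ length bs)) (trans (length-++ (map (λ i → lookup ctx i , w) (b ∷ bs)))
                 (cong (_+ length E) (length-map _ (b ∷ bs)))) ⟩
          suc (length bs + length E + (t ∸ length bs))
            ≡⟨ cong suc (shuffle (length bs) (length E) (t ∸ length bs)) ⟩
          suc (length E + (length bs + (t ∸ length bs)))
            ≡⟨ cong (λ z → suc (length E + z)) (m+[n∸m]≡n (<⇒≤ (≰⇒> t≰))) ⟩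
          suc (length E + t) ≡⟨ sym (+-suc (length E) t) ⟩
          length E + suc t ≤⟨ small ⟩
          size H ∎
          where
          open ≤-Reasoning
          shuffle : ∀ a b c → a + b + c ≡ b + (a + c)
          shuffle = solve-∀
      ... | P , deg , real =
        extend b bs P , cong suc (trans (cong (length bs +_) deg) (m+[n∸m]≡n (<⇒≤ (≰⇒> t≰))))
        , w , tt , fresh , Unique.map⁺ d uniqB , B-adj , real

  -- Bipartiteness excludes the edge between x and h, so the two edges of the initial path are all
  -- the edges among its vertices and the exploration can start with them.
  patternAt : Bipartite H → ∀ {h} → NonStar H h → ∀ t → 2 + t ≤ size H → ∃[ P ] (backDegree P ≡ t × RealizedAt H (Anywhere {H}) h P)
  patternAt (side , bip) {h} (y , x , hy , yx , x≢h) t small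
    with explore t (x ∷ y ∷ h ∷ []) (path-distinct hy yx x≢h) zero ((h , y) ∷ (y , x) ∷ []) cov t ≤-refl small
    where
    same : ∀ {a b c : Bool} → a ≢ b → b ≢ c → c ≡ a
    same {false} {false} p q = ⊥-elim (p refl)
    same {false} {true} {false} p q = refl
    same {false} {true} {true} p q = ⊥-elim (q refl)
    same {true} {true} p q = ⊥-elim (p refl)
    same {true} {false} {true} p q = refl
    same {true} {false} {false} p q = ⊥-elim (q refl)
    ¬xh : ¬ Adj H x h
    ¬xh a = bip x h a (same (bip h y hy) (bip y x yx))
    ctx = x ∷ y ∷ h ∷ []
    cov : ∀ i j → Adj H (lookup ctx i) (lookup ctx j) →
          (lookup ctx i , lookup ctx j) ∈ (h , y) ∷ (y , x) ∷ [] ⊎ (lookup ctx j , lookup ctx i) ∈ (h , y) ∷ (y , x) ∷ []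
    cov (zero) (zero) a = ⊥-elim (Adj-irrefl H a)
    cov (zero) (suc zero) a = inj₂ (there (here refl))
    cov (zero) (suc (suc zero)) a = ⊥-elim (¬xh a)
    cov (suc zero) (zero) a = inj₁ (there (here refl))
    cov (suc zero) (suc zero) a = ⊥-elim (Adj-irrefl H a)
    cov (suc zero) (suc (suc zero)) a = inj₂ (here refl)
    cov (suc (suc zero)) (zero) a = ⊥-elim (¬xh (Adj-sym H a))
    cov (suc (suc zero)) (suc zero) a = inj₁ (here refl)
    cov (suc (suc zero)) (suc (suc zero)) a = ⊥-elim (Adj-irrefl H a)
  ... | P , deg , real = P , deg , y , x , tt , tt , hy , yx , x≢h , real

  private
    -- The potential `toℕ p + 2 * a` bounds the number of bits: a new child shifts p up by one but
    -- lowers a by one, and moving on lowers p by one. Vertices with an index above p have left the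
    -- queue, and all their neighbours are placed.
    search : ∀ L a {k} (p : Fin k) (ctx : Vec (Vertex H) k) → Distinct ctx →
             (∀ {i} → toℕ p < toℕ i → ∀ {w} → Adj H (lookup ctx i) w → Placed ctx w) →
             k + a ≤ order H → toℕ p + 2 * a ≤ L → ∃[ bits ] Realizes H (Anywhere {H}) ctx (treePattern a {k} {L} p bits)
    search L zero p ctx d closed big enough = Vec.replicate L false , tt
    search L (suc a) {k} p ctx d closed big enough
      with em {∃[ w ] (Adj H (lookup ctx p) w × ¬ Placed ctx w)}
    search zero (suc a) p ctx d closed big enough | _ =
      ⊥-elim (<⇒≱ (≤-trans (≤-trans (s≤s z≤n) (m≤n+m (2 * suc a) (toℕ p))) enough) z≤n)
    search (suc L) (suc a) {k} p ctx d closed big enough | yes (w , pw , w∉)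
      with search L a (suc p) (w ∷ ctx) (Distinct-∷ d (λ i eq → w∉ (i , eq))) closed′
             (≤-trans (≤-reflexive (sym (+-suc k a))) big)
             (≤-pred (≤-trans (≤-reflexive (count (toℕ p) a)) enough))
      where
      closed′ : ∀ {i} → toℕ (suc p) < toℕ i → ∀ {z} → Adj H (lookup (w ∷ ctx) i) z → Placed (w ∷ ctx) z
      closed′ {suc i} (s≤s p<i) a = let j , eq = closed p<i a in suc j , eq
      count : ∀ p a → suc (suc p + 2 * a) ≡ p + 2 * suc a
      count = solve-∀
    ... | bits , real = true ∷ bits , w , tt , (λ i eq → w∉ (i , eq)) , [] ∷ [] , pw ∷ [] , real
    search (suc L) (suc a) {k} (suc p) ctx d closed big enough | no none
      with search L (suc a) (inject₁ p) ctx d closed′ big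
             (≤-pred (≤-trans (≤-reflexive (cong (λ z → suc (z + 2 * suc a)) (toℕ-inject₁ p))) enough))
      where
      closed′ : ∀ {i} → toℕ (inject₁ p) < toℕ i → ∀ {w} → Adj H (lookup ctx i) w → Placed ctx w
      closed′ {i} p<i {w} a with i ≟ᶠ suc p
      ... | yes refl = decidable-stable em (λ ¬w → none (w , a , ¬w))
      ... | no i≢ = closed (≤∧≢⇒< (subst (_< toℕ i) (toℕ-inject₁ p) p<i) (i≢ ∘ sym ∘ toℕ-injective)) a
    ... | bits , real = false ∷ bits , real
    -- The queue is empty. By connectedness all vertices would be placed, although `suc a` of them
    -- are still to come.
    search (suc L) (suc a) {suc k} zero ctx d closed big enough | no none =
      ⊥-elim (m+1+n≰m (suc k) (≤-trans big (begin
        order H                                       ≡⟨ sym (length-allFin (order H)) ⟩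
        length (allFin (order H))                     ≤⟨ Unique-⊆-length (Unique.allFin⁺ _) (λ {z} _ → listed z) ⟩
        length (map (lookup ctx) (allFin (suc k)))    ≡⟨ length-map (lookup ctx) (allFin (suc k)) ⟩
        length (allFin (suc k))                       ≡⟨ length-allFin (suc k) ⟩
        suc k                                         ∎)))
      where
      open ≤-Reasoning
      placed : ∀ z → Placed ctx z
      placed z with em {Placed ctx z}
      ... | yes p = p
      ... | no ¬p with boundary (Placed ctx) (zero , refl) ¬p
      ...   | _ , w , (zero , refl) , w∉ , a = ⊥-elim (none (w , a , w∉))
      ...   | _ , w , (suc i , refl) , w∉ , a = ⊥-elim (w∉ (closed (s≤s z≤n) a))
      listed : ∀ z → z ∈ map (lookup ctx) (allFin (suc k))
      listed z = let i , eq = placed z in subst (_∈ map (lookup ctx) (allFin (suc k))) eq (∈-map⁺ (lookup ctx) (∈-allFin i))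

  treePatternAt : ∀ {h} → NonStar H h → ∀ a → 3 + a ≤ order H →
                  ∃[ bits ] RealizedAt H (Anywhere {H}) h (treePattern a {3} {2 + 2 * a} (suc (suc zero)) bits)
  treePatternAt {h} (y , x , hy , yx , x≢h) a big
    with search (2 + 2 * a) a (suc (suc zero)) (x ∷ y ∷ h ∷ []) (path-distinct hy yx x≢h) closed big ≤-refl
    where
    closed : ∀ {i : Fin 3} → 2 < toℕ i → ∀ {w} → Adj H (lookup (x ∷ y ∷ h ∷ []) i) w → Placed (x ∷ y ∷ h ∷ []) w
    closed {suc (suc zero)} (s≤s (s≤s ()))
  ... | bits , real = bits , y , x , tt , tt , hy , yx , x≢h , real

-- Colouring a graph from a list of patterns

-- With Δ = y^q, the hypothesis on N in `light` says that N is at most y^(m(k-1)-e), where the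
-- pattern with its initial path has k = 3 + steps vertices and e = 2 + backDegree edges.
-- `backDegree≤` keeps attaching sets within the sizes that special sets can have.
record WeightedPattern (q Δ β D : ℕ) : Set where
  field
    pattern′     : Pattern 3
    weight       : ℕ
    backDegree≤  : backDegree pattern′ ≤ suc q
    light        : ∀ N → N ^ q * Δ ^ (2 + backDegree pattern′) ≤ Δ ^ (suc q * (2 + steps pattern′)) →
                   D * N ≤ weight * β ^ steps pattern′

two-colours : ∀ {a b p r s : A} → p ≡ a ⊎ p ≡ b → r ≡ a ⊎ r ≡ b → s ≡ a ⊎ s ≡ b → p ≢ r → s ≢ r → p ≡ s
two-colours (inj₁ refl) _ (inj₁ refl) _ _ = refl
two-colours (inj₂ refl) _ (inj₂ refl) _ _ = refl
two-colours (inj₁ refl) (inj₁ refl) (inj₂ refl) p≢r _ = ⊥-elim (p≢r refl)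
two-colours (inj₁ refl) (inj₂ refl) (inj₂ refl) _ s≢r = ⊥-elim (s≢r refl)
two-colours (inj₂ refl) (inj₁ refl) (inj₁ refl) _ s≢r = ⊥-elim (s≢r refl)
two-colours (inj₂ refl) (inj₂ refl) (inj₁ refl) p≢r _ = ⊥-elim (p≢r refl)

module Colouring (em : ExcludedMiddle 0ℓ) (q : ℕ) .{{_ : NonZero q}} (F : Family)
  (F-ok : ∀ {H} → F H → Connected H × suc q ≤ size H)
  (Δ : ℕ) .{{_ : NonZero Δ}} (G : Graph) (G-degree : MaxDegree≤ G Δ) where
  open Indicator em

  private
    m n : ℕ
    m = suc q
    n = order G
    V : Set
    V = Vertex G

    2≤m : 2 ≤ m
    2≤m = s≤s (>-nonZero⁻¹ q)

    neighbours : V → List V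
    neighbours v = filter (λ w → T? (adj G v w)) (allFin n)

    ∈-neighbours⁺ : ∀ {v w} → Adj G v w → w ∈ neighbours v
    ∈-neighbours⁺ {v} a = ∈-filter⁺ (λ w → T? (adj G v w)) (∈-allFin _) a

    ∈-neighbours⁻ : ∀ {v w} → w ∈ neighbours v → Adj G v w
    ∈-neighbours⁻ {v} w∈ = proj₂ (∈-filter⁻ (λ w → T? (adj G v w)) {xs = allFin n} w∈)

    ∑-neighbours : ∀ v → ∑ (allFin n) (λ w → 𝟙 (Adj G v w)) ≤ Δ
    ∑-neighbours v = ≤-trans (≤-reflexive (sym (length-filter≡∑ (λ w → T? (adj G v w)) (allFin n)))) (G-degree v)

    ∑-neighbours′ : ∀ v → ∑ (allFin n) (λ w → 𝟙 (Adj G w v)) ≤ Δ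
    ∑-neighbours′ v = ≤-trans (∑-mono (allFin n) λ _ → 𝟙-mono (Adj-sym G)) (∑-neighbours v)

    common : List V → ℕ
    common zs = ∑ (allFin n) (λ p → 𝟙 (All (Adj G p) zs))

    -- The least integer that is at least y^(m-d) in the notation of the header.
    threshold : ℕ → ℕ
    threshold d = proj₁ (ceilingRoot q (Δ ^ (m ∸ d)))

    Heavy : List V → Set
    Heavy zs = threshold (length zs) ≤ common zs

    Special : List V → Set
    Special zs = 2 ≤ length zs × length zs ≤ m × Unique zs × Heavy zs

  data Violation {C} (S : Subset n) (c : Vec (Fin C) n) : Set where
    edge    : ∀ {u v} → u ∈ₛ S → v ∈ₛ S → Adj G u v → lookup c u ≡ lookup c v → Violation S c
    special : ∀ zs a → Special zs → All (_∈ₛ S) zs → All (λ z → lookup c z ≡ a) zs → Violation S c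
    copy    : ∀ {a b} → a ≢ b → ∀ H → F H → (f : Vertex H → V) → Injective _≡_ _≡_ f →
              (∀ {u v} → Adj H u v → Adj G (f u) (f v)) →
              (∀ u → f u ∈ₛ S × (lookup c (f u) ≡ a ⊎ lookup c (f u) ≡ b)) → Violation S c

  Valid : ∀ {C} → Subset n → Vec (Fin C) n → Set
  Valid S c = ¬ Violation S c

  Valid-antitone : ∀ {C S T} {c : Vec (Fin C) n} → S ⊆ T → Valid T c → Valid S c
  Valid-antitone S⊆T val (edge u∈ v∈ a eq) = val (edge (S⊆T u∈) (S⊆T v∈) a eq)
  Valid-antitone S⊆T val (special zs a sp zs∈ mono) = val (special zs a sp (All.map S⊆T zs∈) mono)
  Valid-antitone S⊆T val (copy a≢b H FH f inj hom col) =
    val (copy a≢b H FH f inj hom λ u → S⊆T (proj₁ (col u)) , proj₂ (col u))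

  Valid-local : ∀ {C S} {c c′ : Vec (Fin C) n} → (∀ {u} → u ∈ₛ S → lookup c u ≡ lookup c′ u) → Valid S c → Valid S c′
  Valid-local agree val (edge u∈ v∈ a eq) = val (edge u∈ v∈ a (trans (agree u∈) (trans eq (sym (agree v∈)))))
  Valid-local agree val (special zs a sp zs∈ mono) =
    val (special zs a sp zs∈ (All.zipWith (λ (z∈ , eq) → trans (agree z∈) eq) (zs∈ , mono)))
  Valid-local agree val (copy a≢b H FH f inj hom col) =
    val (copy a≢b H FH f inj hom λ u → proj₁ (col u) , recolour (agree (proj₁ (col u))) (proj₂ (col u)))
    where
    recolour : ∀ {p p′ a b : Fin _} → p ≡ p′ → p′ ≡ a ⊎ p′ ≡ b → p ≡ a ⊎ p ≡ b
    recolour refl x = x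

  Valid-⊥ : ∀ {C} (c : Vec (Fin C) n) → Valid ⊥ c
  Valid-⊥ c (edge u∈ _ _ _) = ∉⊥ u∈
  Valid-⊥ c (special (z ∷ _) _ _ (z∈ ∷ _) _) = ∉⊥ z∈
  Valid-⊥ c (copy _ H FH f _ _ col) = ∉⊥ (proj₁ (col someVertex))
    where
    -- A graph without vertices would be contained in every graph; having at least m edges excludes
    -- it from F.
    someVertex : Vertex H
    someVertex with em {Vertex H}
    ... | yes h = h
    ... | no ¬h = ⊥-elim (<⇒≱ (≤-trans (s≤s z≤n) (proj₂ (F-ok FH))) (size-≤ H [] (λ {u} _ → ⊥-elim (¬h u))))

  -- The events at a vertex and their number

  module _ (S : Subset n) (v : V) where

    edgeEvents : List (Event n)
    edgeEvents = map (λ u → (v , u) ∷ []) (neighbours v)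

    edgeEvents-at : ∀ {e} → e ∈ edgeEvents → EventAt S v 0 e
    edgeEvents-at e∈ with ∈-map⁻ (λ u → (v , u) ∷ []) e∈
    ... | u , u∈ , refl = record
      { representative = u ; rest = [] ; shape = refl ; rest-length = refl ; rest-∈ = []
      ; independent = (Adj-≢ G (∈-neighbours⁻ u∈) ∷ []) , ([] ∷ []) }

    SpecialTail : ∀ {i} → Vec V i → Set
    SpecialTail zs = Special (v ∷ Vec.toList zs) × All (_∈ₛ S) (Vec.toList zs)

    specialTails : ∀ i → List (Vec V i)
    specialTails i = filter (λ zs → em {SpecialTail zs}) (vecs (allFin n) i)

    -- All vertices copy the colour of z, which itself is kept. A special set of i + 2 vertices thus
    -- determines the colours of v and of i others.
    specialEvent : ∀ {i} → Vec V (suc i) → Event n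
    specialEvent (z ∷ zs) = (v , z) ∷ map (_, z) (Vec.toList zs)

    specialEvents : ℕ → List (Event n)
    specialEvents i = map specialEvent (specialTails (suc i))

    specialEvents-at : ∀ i {e} → e ∈ specialEvents i → EventAt S v i e
    specialEvents-at i e∈ with ∈-map⁻ specialEvent e∈
    ... | z ∷ zs , z∈ , refl with ∈-filter⁻ (λ zs → em {SpecialTail zs}) {xs = vecs (allFin n) (suc i)} z∈
    ...   | _ , (_ , _ , (v≢z ∷ v≢zs) ∷ z≢zs ∷ uniq , _) , (_ ∷ zs∈) = record
      { representative = z ; rest = map (_, z) (Vec.toList zs) ; shape = refl
      ; rest-length = trans (length-map _ (Vec.toList zs)) (length-toList zs)
      ; rest-∈ = All.map⁺ zs∈
      ; independent = v≢z ∷ All.map⁺ (All.map (_∘ sym) z≢zs)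
                    , All.map⁺ (All.map (_, v≢z) v≢zs) ∷ AllPairs.map⁺ (pairs (Vec.toList zs) z≢zs uniq) }
      where
      pairs : ∀ us → All (z ≢_) us → Unique us → AllPairs (λ u u′ → u ≢ u′ × u ≢ z) us
      pairs []       _         _            = []
      pairs (u ∷ us) (z≢u ∷ p) (u≢us ∷ uniq) = All.map (_, (z≢u ∘ sym)) u≢us ∷ pairs us p uniq

    ∑-All : ∀ (P : V → Set) k → ∑ (vecs (allFin n) k) (λ zs → 𝟙 (All P (Vec.toList zs))) ≡ ∑ (allFin n) (𝟙 ∘ P) ^ k
    ∑-All P zero    = trans (+-identityʳ _) (𝟙-yes [])
    ∑-All P (suc k) = begin
      ∑ (vecs (allFin n) (suc k)) (λ zs → 𝟙 (All P (Vec.toList zs)))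
        ≡⟨ ∑-vecs (allFin n) k _ ⟩
      ∑ (allFin n) (λ a → ∑ (vecs (allFin n) k) (λ zs → 𝟙 (All P (a ∷ Vec.toList zs))))
        ≡⟨ ∑-cong (allFin n) (λ a → trans
             (∑-cong (vecs (allFin n) k) λ zs → trans (𝟙-cong (λ { (p ∷ ps) → ps , p }) (λ (ps , p) → p ∷ ps)) 𝟙-×)
             (sym (∑-* (vecs (allFin n) k) _ (𝟙 (P a))))) ⟩
      ∑ (allFin n) (λ a → X * 𝟙 (P a))
        ≡⟨ ∑-cong (allFin n) (λ a → *-comm X (𝟙 (P a))) ⟩
      ∑ (allFin n) (λ a → 𝟙 (P a) * X)
        ≡⟨ sym (∑-* (allFin n) (𝟙 ∘ P) X) ⟩
      ∑ (allFin n) (𝟙 ∘ P) * X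
        ≡⟨ cong (∑ (allFin n) (𝟙 ∘ P) *_) (∑-All P k) ⟩
      ∑ (allFin n) (𝟙 ∘ P) ^ suc k ∎
      where
      open ≡-Reasoning
      X = ∑ (vecs (allFin n) k) (λ zs → 𝟙 (All P (Vec.toList zs)))

    ∑-filter-≤ : ∀ {P : A → Set} (P? : Decidable P) xs (f : A → ℕ) → ∑ (filter P? xs) f ≤ ∑ xs f
    ∑-filter-≤ P? []       f = z≤n
    ∑-filter-≤ P? (x ∷ xs) f with P? x
    ... | yes _ = +-monoʳ-≤ (f x) (∑-filter-≤ P? xs f)
    ... | no _  = ≤-trans (∑-filter-≤ P? xs f) (m≤n+m _ (f x))

    -- Pairs of a special set at v and a common neighbour p are counted twice: p is one of at most Δ
    -- neighbours of v, and the k other vertices are neighbours of p.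
    specialTails-threshold : ∀ k → length (specialTails k) * threshold (suc k) ≤ Δ * Δ ^ k
    specialTails-threshold k = begin
      length Z * threshold (suc k) ≡⟨ sym (∑-const Z _) ⟩
      ∑ Z (λ _ → threshold (suc k)) ≤⟨ ∑-mono Z heavy ⟩
      ∑ Z (λ zs → common (v ∷ Vec.toList zs)) ≡⟨ ∑-swap Z (allFin n) _ ⟩
      ∑ (allFin n) (λ p → ∑ Z (λ zs → 𝟙 (All (Adj G p) (v ∷ Vec.toList zs))))
        ≤⟨ ∑-mono (allFin n) (λ {p} _ → begin
             ∑ Z (λ zs → 𝟙 (All (Adj G p) (v ∷ Vec.toList zs)))
               ≤⟨ ∑-filter-≤ _ (vecs (allFin n) k) _ ⟩
             ∑ (vecs (allFin n) k) (λ zs → 𝟙 (All (Adj G p) (v ∷ Vec.toList zs)))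
               ≡⟨ ∑-cong (vecs (allFin n) k) (λ zs → trans (𝟙-cong (λ { (a ∷ as) → as , a }) (λ (as , a) → a ∷ as)) 𝟙-×) ⟩
             ∑ (vecs (allFin n) k) (λ zs → 𝟙 (All (Adj G p) (Vec.toList zs)) * 𝟙 (Adj G p v))
               ≡⟨ sym (∑-* (vecs (allFin n) k) _ (𝟙 (Adj G p v))) ⟩
             ∑ (vecs (allFin n) k) (λ zs → 𝟙 (All (Adj G p) (Vec.toList zs))) * 𝟙 (Adj G p v)
               ≡⟨ cong (_* 𝟙 (Adj G p v)) (∑-All (Adj G p) k) ⟩
             ∑ (allFin n) (λ w → 𝟙 (Adj G p w)) ^ k * 𝟙 (Adj G p v)
               ≤⟨ *-monoˡ-≤ _ (^-monoˡ-≤ k (∑-neighbours p)) ⟩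
             Δ ^ k * 𝟙 (Adj G p v)
               ≡⟨ *-comm (Δ ^ k) _ ⟩
             𝟙 (Adj G p v) * Δ ^ k ∎) ⟩
      ∑ (allFin n) (λ p → 𝟙 (Adj G p v) * Δ ^ k) ≡⟨ sym (∑-* (allFin n) _ (Δ ^ k)) ⟩
      ∑ (allFin n) (λ p → 𝟙 (Adj G p v)) * Δ ^ k ≤⟨ *-monoˡ-≤ (Δ ^ k) (∑-neighbours′ v) ⟩
      Δ * Δ ^ k ∎
      where
      open ≤-Reasoning
      Z = specialTails k
      heavy : ∀ {zs} → zs ∈ Z → threshold (suc k) ≤ common (v ∷ Vec.toList zs)
      heavy {zs} z∈ with ∈-filter⁻ (λ zs → em {SpecialTail zs}) {xs = vecs (allFin n) k} z∈
      ... | _ , (_ , _ , _ , h) , _ = subst (λ l → threshold (suc l) ≤ common (v ∷ Vec.toList zs)) (length-toList zs) h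

    -- For d = i + 2, dividing Δ^d = y^((m-1)d) by the threshold y^(m-d) leaves y^(m(d-1)), and
    -- `Δ ^ m ≤ x ^ q` means that y^m is at most x.
    specialEvents-few : ∀ {x} → Δ ^ m ≤ x ^ q → ∀ i → i < q → length (specialEvents i) ≤ x ^ suc i
    specialEvents-few {x} Δ≤x i i<q = ^-cancelˡ-≤ q (begin
      length (specialEvents i) ^ q     ≡⟨ cong (_^ q) (length-map specialEvent (specialTails (suc i))) ⟩
      M ^ q                            ≤⟨ *-cancelʳ-≤ _ _ (Δ ^ r) {{m^n≢0 Δ r}} (begin
        M ^ q * Δ ^ r          ≤⟨ *-monoʳ-≤ (M ^ q) (proj₁ (proj₂ (ceilingRoot q (Δ ^ r)))) ⟩
        M ^ q * t ^ q          ≡⟨ sym (^-distribʳ-* M t q) ⟩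
        (M * t) ^ q            ≤⟨ ^-monoˡ-≤ q (specialTails-threshold (suc i)) ⟩
        (Δ ^ (2 + i)) ^ q      ≡⟨ ^-*-assoc Δ (2 + i) q ⟩
        Δ ^ ((2 + i) * q)      ≡⟨ cong (Δ ^_) exponents ⟩
        Δ ^ (m * suc i + r)    ≡⟨ ^-distribˡ-+-* Δ (m * suc i) r ⟩
        Δ ^ (m * suc i) * Δ ^ r ∎) ⟩
      Δ ^ (m * suc i)                  ≡⟨ sym (^-*-assoc Δ m (suc i)) ⟩
      (Δ ^ m) ^ suc i                  ≤⟨ ^-monoˡ-≤ (suc i) Δ≤x ⟩
      (x ^ q) ^ suc i                  ≡⟨ ^-swap x q (suc i) ⟩
      (x ^ suc i) ^ q                  ∎)
      where
      open ≤-Reasoning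
      M = length (specialTails (suc i))
      r = m ∸ (2 + i)
      t = threshold (2 + i)
      arith : ∀ i r → (2 + i) * (suc i + r) ≡ (suc (suc i + r)) * suc i + r
      arith = solve-∀
      exponents : (2 + i) * q ≡ m * suc i + r
      exponents = subst (λ q → (2 + i) * q ≡ suc q * suc i + r) (m+[n∸m]≡n i<q) (arith i r)

    HeavySet : List V → Set
    HeavySet zs = 2 ≤ length zs × Heavy zs

    Attachable : ∀ {k} → Vec V k → List V → V → Set
    Attachable ctx zs w = w ∈ₛ S × (∀ i → lookup ctx i ≢ w) × All (λ z → Adj G z w) zs

    -- Listing nothing for a heavy set makes the bound on the length unconditional. No copy is lost,
    -- because the sets that arise from a copy are monochromatic, hence not special (see
    -- `extension-exists`).
    candidates : ∀ {k} → Vec V k → List V → List V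
    candidates ctx zs with em {HeavySet zs}
    ... | yes _ = []
    ... | no _  = filter (λ w → em {Attachable ctx zs w}) (allFin n)

    ∈-candidates⁻ : ∀ {k} (ctx : Vec V k) zs {w} → w ∈ candidates ctx zs → Attachable ctx zs w
    ∈-candidates⁻ ctx zs w∈ with em {HeavySet zs}
    ... | no _ = proj₂ (∈-filter⁻ (λ w → em {Attachable ctx zs w}) {xs = allFin n} w∈)

    ∈-candidates⁺ : ∀ {k} (ctx : Vec V k) zs {w} → ¬ HeavySet zs → Attachable ctx zs w → w ∈ candidates ctx zs
    ∈-candidates⁺ ctx zs ¬heavy w-ok with em {HeavySet zs}
    ... | yes h = ⊥-elim (¬heavy h)
    ... | no _  = ∈-filter⁺ (λ w → em {Attachable ctx zs w}) (∈-allFin _) w-ok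

    capacity : ℕ → ℕ
    capacity zero          = 0
    capacity (suc zero)    = Δ
    capacity d@(suc (suc _)) = pred (threshold d)

    candidates-few : ∀ {k} (ctx : Vec V k) z zs → length (candidates ctx (z ∷ zs)) ≤ capacity (suc (length zs))
    candidates-few ctx z zs with em {HeavySet (z ∷ zs)}
    ... | yes _ = z≤n
    candidates-few ctx z [] | no _ = ≤-trans (≤-reflexive (length-filter≡∑ _ (allFin n)))
      (≤-trans (∑-mono (allFin n) λ _ → 𝟙-mono λ { (_ , _ , a ∷ []) → a }) (∑-neighbours z))
    candidates-few ctx z (z′ ∷ zs) | no ¬heavy = ≤-trans (≤-reflexive (length-filter≡∑ _ (allFin n)))
      (≤-trans (∑-mono (allFin n) λ _ → 𝟙-mono λ (_ , _ , as) → All.map (Adj-sym G) as)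
               (<⇒≤pred (≰⇒> λ h → ¬heavy (s≤s (s≤s z≤n) , h))))

    -- This is `capacity d` at most y^(m-d), raised to the power q. For d = 1 it is the degree
    -- bound; for larger d, the predecessor of the least integer that reaches y^(m-d) lies below it,
    -- so rounding costs nothing.
    capacity-bound : ∀ d → 1 ≤ d → d ≤ m → capacity d ^ q * Δ ^ d ≤ Δ ^ m
    capacity-bound (suc zero) _ _ = ≤-reflexive (trans (sym (^-distribˡ-+-* Δ q 1)) (cong (Δ ^_) (+-comm q 1)))
    capacity-bound d@(suc (suc _)) _ d≤m = ≤-trans (*-monoˡ-≤ (Δ ^ d) below)
      (≤-reflexive (trans (sym (^-distribˡ-+-* Δ (m ∸ d) d)) (cong (Δ ^_) (m∸n+n≡m d≤m))))
      where
      root = ceilingRoot q (Δ ^ (m ∸ d))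
      below : pred (threshold d) ^ q ≤ Δ ^ (m ∸ d)
      below with proj₁ root | proj₁ (proj₂ root) | proj₂ (proj₂ root)
      ... | zero  | le | _  = ⊥-elim (<⇒≱ (m^n>0 Δ (m ∸ d)) (≤-trans le (≤-reflexive (0^ q))))
        where
        0^ : ∀ q .{{_ : NonZero q}} → 0 ^ q ≡ 0
        0^ (suc _) = refl
      ... | suc t | _  | lt = <⇒≤ (lt t ≤-refl)

    patternCapacity : ∀ {k} → Pattern k → ℕ
    patternCapacity done            = 1
    patternCapacity (extend b bs P) = capacity (suc (length bs)) * patternCapacity P

    -- The factors y^(m-d) of the steps multiply to y^(m steps - backDegree).
    patternCapacity-bound : ∀ {k} (P : Pattern k) → backDegree P ≤ m →
                            patternCapacity P ^ q * Δ ^ backDegree P ≤ Δ ^ (m * steps P)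
    patternCapacity-bound done _ = ≤-reflexive (trans (*-identityʳ _) (trans (^-zeroˡ q) (sym (cong (Δ ^_) (*-zeroʳ m)))))
    patternCapacity-bound (extend b bs P) deg≤ = begin
      (capacity d * patternCapacity P) ^ q * Δ ^ (d + backDegree P)
        ≡⟨ cong₂ _*_ (^-distribʳ-* (capacity d) (patternCapacity P) q) (^-distribˡ-+-* Δ d (backDegree P)) ⟩
      capacity d ^ q * patternCapacity P ^ q * (Δ ^ d * Δ ^ backDegree P)
        ≡⟨ interchange (capacity d ^ q) (patternCapacity P ^ q) (Δ ^ d) (Δ ^ backDegree P) ⟩
      capacity d ^ q * Δ ^ d * (patternCapacity P ^ q * Δ ^ backDegree P)
        ≤⟨ *-mono-≤ (capacity-bound d (s≤s z≤n) (≤-trans (m≤m+n d (backDegree P)) deg≤))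
                    (patternCapacity-bound P (≤-trans (m≤n+m (backDegree P) d) deg≤)) ⟩
      Δ ^ m * Δ ^ (m * steps P)
        ≡⟨ sym (^-distribˡ-+-* Δ m (m * steps P)) ⟩
      Δ ^ (m + m * steps P)
        ≡⟨ cong (Δ ^_) (sym (*-suc m (steps P))) ⟩
      Δ ^ (m * suc (steps P)) ∎
      where
      open ≤-Reasoning
      d = suc (length bs)
      interchange : ∀ a b c d → a * b * (c * d) ≡ a * c * (b * d)
      interchange = solve-∀

    module _ (x y : V) where

      -- Adjacent vertices of a two-coloured copy have different colours: those on the
      -- side `true` are coloured like x, the others like y.
      rep : Bool → V
      rep true  = x
      rep false = y

      extensions : ∀ {k} → Vec V k → Vec Bool k → Pattern k → List (Event n)
      extensions ctx sides done            = [] ∷ []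
      extensions ctx sides (extend b bs P) =
        concatMap (λ w → map ((w , rep s) ∷_) (extensions (w ∷ ctx) (s ∷ sides) P))
                  (candidates ctx (map (lookup ctx) (b ∷ bs)))
        where s = not (lookup sides b)

      extensions-few : ∀ {k} (ctx : Vec V k) sides P → length (extensions ctx sides P) ≤ patternCapacity P
      extensions-few ctx sides done            = ≤-refl
      extensions-few ctx sides (extend b bs P) = ≤-trans
        (length-concatMap-≤ _ (candidates ctx (map (lookup ctx) (b ∷ bs))) λ {w} _ →
          ≤-trans (≤-reflexive (length-map _ (extensions (w ∷ ctx) _ P))) (extensions-few (w ∷ ctx) _ P))
        (*-monoˡ-≤ (patternCapacity P) (subst (λ l → length (candidates ctx (map (lookup ctx) (b ∷ bs))) ≤ capacity (suc l))
          (length-map (lookup ctx) bs) (candidates-few ctx (lookup ctx b) (map (lookup ctx) bs))))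

      Placed : ∀ {k} → Vec V k → V → Set
      Placed ctx w = ∃[ i ] lookup ctx i ≡ w

      FreshPair : ∀ {k} → Vec V k → V × V → Set
      FreshPair ctx (u , w) = u ∈ₛ S × (∀ i → lookup ctx i ≢ u) × (w ≡ x ⊎ w ≡ y)

      -- Every recoloured vertex is new to a context that contains x and y. Hence no representative
      -- is recoloured and no vertex is recoloured twice, which is what independence asks.
      extensions-fresh : ∀ {k} (ctx : Vec V k) sides P → Placed ctx x → Placed ctx y → ∀ {e} → e ∈ extensions ctx sides P →
                         length e ≡ steps P × All (FreshPair ctx) e × Independent e
      extensions-fresh ctx sides done px py (here refl) = refl , [] , [] , []
      extensions-fresh ctx sides (extend b bs P) (ix , px) (iy , py) e∈
        with find (∈-concatMap⁻ _ {xs = candidates ctx (map (lookup ctx) (b ∷ bs))} e∈)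
      ... | w , w∈ , e∈′ with ∈-map⁻ _ e∈′ | ∈-candidates⁻ ctx (map (lookup ctx) (b ∷ bs)) w∈
      ...   | e , e∈″ , refl | w∈S , fresh , _
              with extensions-fresh (w ∷ ctx) _ P (suc ix , px) (suc iy , py) e∈″
      ...     | len , pairs , irr , ind =
        cong suc len
        , (w∈S , fresh , rep-xy s) ∷ All.map (λ (u∈ , fr , xy) → u∈ , (λ i → fr (suc i)) , xy) pairs
        , (w≢ (rep-xy s)) ∷ irr
        , All.map (λ (_ , fr , xy) → fr zero , w≢ xy) pairs ∷ ind
        where
        s = not (lookup sides b)
        rep-xy : ∀ s → rep s ≡ x ⊎ rep s ≡ y
        rep-xy true  = inj₁ refl
        rep-xy false = inj₂ refl
        w≢ : ∀ {z} → z ≡ x ⊎ z ≡ y → w ≢ z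
        w≢ (inj₁ refl) eq = fresh ix (trans px (sym eq))
        w≢ (inj₂ refl) eq = fresh iy (trans py (sym eq))

    pathExtensions : Pattern 3 → V → V → List (Event n)
    pathExtensions P y x = map ((v , x) ∷_) (extensions x y (x ∷ y ∷ v ∷ []) (true ∷ false ∷ true ∷ []) P)

    secondNeighbours : V → List V
    secondNeighbours y = filter (λ x → ¬? (x ≟ᶠ v)) (neighbours y)

    patternEvents : Pattern 3 → List (Event n)
    patternEvents P = concatMap (λ y → concatMap (pathExtensions P y) (secondNeighbours y)) (neighbours v)

    patternEvents-few : ∀ P → length (patternEvents P) ≤ Δ * (Δ * patternCapacity P)
    patternEvents-few P = ≤-trans
      (length-concatMap-≤ _ (neighbours v) λ {y} _ → ≤-trans
        (length-concatMap-≤ (pathExtensions P y) (secondNeighbours y) λ {x} _ →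
          ≤-trans (≤-reflexive (length-map _ (extensions x y _ _ P))) (extensions-few x y _ _ P))
        (*-monoˡ-≤ (patternCapacity P) (≤-trans (length-filter _ (neighbours y)) (G-degree y))))
      (*-monoˡ-≤ (Δ * patternCapacity P) (G-degree v))

    -- The choices of y and x contribute Δ^2 = y^(2m-2), as two further vertices attached by one
    -- edge each; with the steps this is y^(m(k-1)-e).
    patternEvents-count : ∀ P → backDegree P ≤ m →
                          length (patternEvents P) ^ q * Δ ^ (2 + backDegree P) ≤ Δ ^ (m * (2 + steps P))
    patternEvents-count P deg≤ = begin
      length (patternEvents P) ^ q * Δ ^ (2 + backDegree P)
        ≤⟨ *-monoˡ-≤ _ (^-monoˡ-≤ q (patternEvents-few P)) ⟩
      (Δ * (Δ * c)) ^ q * Δ ^ (2 + backDegree P)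
        ≡⟨ cong (_* Δ ^ (2 + backDegree P)) (trans (^-distribʳ-* Δ (Δ * c) q) (cong (Δ ^ q *_) (^-distribʳ-* Δ c q))) ⟩
      Δ ^ q * (Δ ^ q * c ^ q) * (Δ * (Δ * Δ ^ backDegree P))
        ≡⟨ shuffle (Δ ^ q) (c ^ q) Δ (Δ ^ backDegree P) ⟩
      Δ ^ m * (Δ ^ m * (c ^ q * Δ ^ backDegree P))
        ≤⟨ *-monoʳ-≤ (Δ ^ m) (*-monoʳ-≤ (Δ ^ m) (patternCapacity-bound P deg≤)) ⟩
      Δ ^ m * (Δ ^ m * Δ ^ (m * steps P))
        ≡⟨ sym (trans (^-distribˡ-+-* Δ m (m + m * steps P)) (cong (Δ ^ m *_) (^-distribˡ-+-* Δ m (m * steps P)))) ⟩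
      Δ ^ (m + (m + m * steps P))
        ≡⟨ cong (Δ ^_) (arith m (steps P)) ⟩
      Δ ^ (m * (2 + steps P)) ∎
      where
      open ≤-Reasoning
      c = patternCapacity P
      shuffle : ∀ a b d e → a * (a * b) * (d * (d * e)) ≡ d * a * (d * a * (b * e))
      shuffle = solve-∀
      arith : ∀ m s → m + (m + m * s) ≡ m * (2 + s)
      arith = solve-∀

    patternEvents-at : ∀ P {e} → e ∈ patternEvents P → EventAt S v (steps P) e
    patternEvents-at P e∈ with find (∈-concatMap⁻ _ {xs = neighbours v} e∈)
    ... | y , y∈ , e∈′ with find (∈-concatMap⁻ (pathExtensions P y) {xs = secondNeighbours y} e∈′)
    ...   | x , x∈ , e∈″ with ∈-map⁻ ((v , x) ∷_) e∈″
    ...     | e , e∈‴ , refl with extensions-fresh x y (x ∷ y ∷ v ∷ []) (true ∷ false ∷ true ∷ []) P (zero , refl) (suc zero , refl) e∈‴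
    ...       | len , pairs , irr , ind = record
      { representative = x ; rest = e ; shape = refl ; rest-length = len ; rest-∈ = All.map proj₁ pairs
      ; independent = v≢x ∷ irr , All.map (λ (_ , fr , xy) → fr (suc (suc zero)) , v≢ xy) pairs ∷ ind }
      where
      v≢x : v ≢ x
      v≢x eq = proj₂ (∈-filter⁻ (λ x → ¬? (x ≟ᶠ v)) {xs = neighbours y} x∈) (sym eq)
      v≢ : ∀ {z} → z ≡ x ⊎ z ≡ y → v ≢ z
      v≢ (inj₁ refl) = v≢x
      v≢ (inj₂ refl) = Adj-≢ G (∈-neighbours⁻ y∈)

  private
    Special-resp-↭ : ∀ {zs zs′} → zs ↭ zs′ → Special zs → Special zs′
    Special-resp-↭ {zs} {zs′} perm (two , len , uniq , heavy) =
      subst (2 ≤_) eq two , subst (_≤ m) eq len , Unique-resp-↭ (setoid V) (↭⇒↭ₛ perm) uniq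
      , subst (λ l → threshold l ≤ common zs′) eq
          (≤-trans heavy (∑-mono (allFin n) λ _ → 𝟙-mono (All-resp-↭ perm)))
      where
      eq = ↭-length perm

    -- Since y^0 = 1, a single common neighbour makes m distinct vertices special; in particular
    -- this applies to m leaves of a star.
    threshold-m : threshold m ≤ 1
    threshold-m with ceilingRoot q (Δ ^ (m ∸ m))
    ... | t , _ , below with t ≤? 1
    ...   | yes t≤1 = t≤1
    ...   | no t≰1 = ⊥-elim (<⇒≱ (below 1 (≰⇒> t≰1))
              (≤-reflexive (trans (cong (Δ ^_) (n∸n≡0 m)) (sym (^-zeroˡ q)))))

    -- Without a path h - y - x, connectedness leaves no vertex at distance two from h, and an edge
    -- avoiding h would complete such a path. So all edges of H contain h.
    star-neighbours : ∀ {H} → F H → ∀ {h} → ¬ NonStar H h →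
                      m ≤ length (filter (λ w → T? (adj H h w)) (allFin (order H)))
    star-neighbours {H} FH {h} star = ≤-trans (proj₂ (F-ok FH)) (≤-trans
      (size-≤ H (map (h ,_) N) covered) (≤-reflexive (length-map (h ,_) N)))
      where
      open Exploration em H (proj₁ (F-ok FH)) using (boundary)
      N = filter (λ w → T? (adj H h w)) (allFin (order H))
      near : ∀ z → z ≡ h ⊎ Adj H h z
      near z with em {z ≡ h ⊎ Adj H h z}
      ... | yes p = p
      ... | no ¬p with boundary (λ z → z ≡ h ⊎ Adj H h z) (inj₁ refl) ¬p
      ...   | _ , w , inj₁ refl , w∉ , a = ⊥-elim (w∉ (inj₂ a))
      ...   | p , w , inj₂ hp , w∉ , a = ⊥-elim (star (p , w , hp , a , w∉ ∘ inj₁))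
      listed : ∀ {w} → Adj H h w → (h , w) ∈ map (h ,_) N
      listed a = ∈-map⁺ (h ,_) (∈-filter⁺ (λ w → T? (adj H h w)) (∈-allFin _) a)
      covered : ∀ {u v} → Adj H u v → (u , v) ∈ map (h ,_) N ⊎ (v , u) ∈ map (h ,_) N
      covered {u} {v} a with near u | near v
      ... | inj₁ refl | _         = inj₁ (listed a)
      ... | inj₂ _    | inj₁ refl = inj₂ (listed (Adj-sym H a))
      ... | inj₂ hu   | inj₂ hv   = ⊥-elim (star (u , v , hu , a , Adj-≢ H hv ∘ sym))

  -- Every violation at a new vertex forces an event

  module _ {β D : ℕ} (Ps : List (WeightedPattern q Δ β D))
    (covers : ∀ {H} → F H → ∀ {h} → NonStar H h →
              ∃[ wp ] (wp ∈ Ps × RealizedAt H (Anywhere {H}) h (WeightedPattern.pattern′ wp)))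
    where
    open WeightedPattern

    module _ {C : ℕ} (S : Subset n) (v : V) (c : Vec (Fin C) n) (val : Valid (S - v) c) where

      private
        S′ : Subset n
        S′ = S - v

      Cause : Set
      Cause = (∃[ e ] (e ∈ edgeEvents S′ v × Forced c e))
            ⊎ (∃[ i ] (i < q × ∃[ e ] (e ∈ specialEvents S′ v i × Forced c e)))
            ⊎ (∃[ wp ] (wp ∈ Ps × ∃[ e ] (e ∈ patternEvents S′ v (pattern′ wp) × Forced c e)))

      edge-cause : ∀ {u w} → u ∈ₛ S → w ∈ₛ S → Adj G u w → lookup c u ≡ lookup c w → Cause
      edge-cause {u} {w} u∈ w∈ a eq with u ≟ᶠ v | w ≟ᶠ v
      ... | yes refl | _ = inj₁ (_ , ∈-map⁺ (λ u → (v , u) ∷ []) (∈-neighbours⁺ a) , eq ∷ [])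
      ... | no _ | yes refl = inj₁ (_ , ∈-map⁺ (λ u → (v , u) ∷ []) (∈-neighbours⁺ (Adj-sym G a)) , sym eq ∷ [])
      ... | no u≢ | no w≢ = ⊥-elim (val (edge (x∈p∧x≢y⇒x∈p-y u∈ u≢) (x∈p∧x≢y⇒x∈p-y w∈ w≢) a eq))

      -- Events name v first, while a special set may contain v anywhere; being special is invariant
      -- under permutation.
      special-cause : ∀ zs a → Special zs → All (_∈ₛ S) zs → All (λ z → lookup c z ≡ a) zs → Cause
      special-cause zs a sp zs∈ mono with em {v ∈ zs}
      ... | no v∉ = ⊥-elim (val (special zs a sp (All.tabulate λ {z} z∈ →
              x∈p∧x≢y⇒x∈p-y (All.lookup zs∈ z∈) λ { refl → v∉ z∈ }) mono))
      ... | yes v∈ with ∈-∃++ v∈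
      ...   | ys , ws , refl = front (ys ++ ws) (Special-resp-↭ perm sp) (All-resp-↭ perm zs∈) (All-resp-↭ perm mono)
        where
        perm : ys ++ v ∷ ws ↭ v ∷ ys ++ ws
        perm = shift v ys ws
        front : ∀ us → Special (v ∷ us) → All (_∈ₛ S) (v ∷ us) → All (λ z → lookup c z ≡ a) (v ∷ us) → Cause
        front [] (s≤s () , _) _ _
        front (z ∷ us) sp@(_ , s≤s len , v≢ ∷ _ , _) (_ ∷ us∈) (va ∷ za ∷ mono) =
          inj₂ (inj₁ (length us , len , _ , ∈-map⁺ (specialEvent S′ v) tail∈
                     , trans va (sym za) ∷ All.map⁺ (subst (All _) (sym list≡) (All.map (λ eq → trans eq (sym za)) mono))))
          where
          tail = z ∷ Vec.fromList us
          list≡ : Vec.toList (Vec.fromList us) ≡ us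
          list≡ = toList∘fromList us
          tail∈ : tail ∈ specialTails S′ v (suc (length us))
          tail∈ = ∈-filter⁺ (λ zs → em {SpecialTail S′ v zs}) (∈-vecs ∈-allFin tail)
            ( subst (λ l → Special (v ∷ z ∷ l)) (sym list≡) sp
            , subst (λ l → All (_∈ₛ S′) (z ∷ l)) (sym list≡)
                (All.zipWith (λ (u∈ , v≢u) → x∈p∧x≢y⇒x∈p-y u∈ (v≢u ∘ sym)) (us∈ , v≢)))

      module _ (v∈S : v ∈ₛ S) (proper : ∀ {u w} → u ∈ₛ S → w ∈ₛ S → Adj G u w → lookup c u ≢ lookup c w)
        (no-special : ∀ zs a → Special zs → All (_∈ₛ S) zs → ¬ All (λ z → lookup c z ≡ a) zs)
        {a b : Fin C} where

        K : V → Set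
        K w = w ∈ₛ S × (lookup c w ≡ a ⊎ lookup c w ≡ b)

        module _ {x y : V} (Kx : K x) (Ky : K y) (x~y : Adj G x y) where

          rep-≢ : ∀ s → lookup c (rep S′ v x y s) ≢ lookup c (rep S′ v x y (not s))
          rep-≢ true  = proper (proj₁ Kx) (proj₁ Ky) x~y
          rep-≢ false = proper (proj₁ Ky) (proj₁ Kx) (Adj-sym G x~y)

          rep-K : ∀ s → K (rep S′ v x y s)
          rep-K true  = Kx
          rep-K false = Ky

          -- The hypothesis on `sides` says that each placed vertex is coloured like the
          -- representative of its side. The placed neighbours of w all have the colour opposite to
          -- that of w, so they are monochromatic, and `no-special` keeps w among the candidates.
          extension-exists : ∀ {k} (ctx : Vec V k) sides P → backDegree P ≤ m → (∀ i → K (lookup ctx i)) →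
                             (∃[ i ] lookup ctx i ≡ v) →
                             (∀ i → lookup c (lookup ctx i) ≡ lookup c (rep S′ v x y (lookup sides i))) →
                             Realizes G K ctx P → ∃[ e ] (e ∈ extensions S′ v x y ctx sides P × Forced c e)
          extension-exists ctx sides done _ _ _ _ _ = [] , here refl , []
          extension-exists ctx sides (extend b₀ bs P) deg≤ ctx-K (iv , v≡) coloured (w , Kw , fresh , uniq , adjs , real) =
            (w , rep S′ v x y s) ∷ e
            , ∈-concatMap _ w∈ (∈-map⁺ ((w , rep S′ v x y s) ∷_) e∈)
            , same ∷ forced
            where
            s = not (lookup sides b₀)
            zs = map (lookup ctx) (b₀ ∷ bs)
            w≢v : w ≢ v
            w≢v eq = fresh iv (trans v≡ (sym eq))
            zs-adj : All (λ z → Adj G z w) zs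
            zs-adj = All.map⁺ adjs
            zs-K : All K zs
            zs-K = All.map⁺ (All.tabulate λ {i} _ → ctx-K i)
            same : lookup c w ≡ lookup c (rep S′ v x y s)
            same = two-colours (proj₂ Kw) (proj₂ (ctx-K b₀)) (proj₂ (rep-K s))
              (proper (proj₁ Kw) (proj₁ (ctx-K b₀)) (Adj-sym G (All.head adjs)))
              (λ eq → rep-≢ (lookup sides b₀) (sym (trans eq (coloured b₀))))
            -- To be special, a heavy set must also be repetition-free and of size at most m: the
            -- realization gives the former, the edge budget the latter.
            not-heavy : ¬ HeavySet S′ v zs
            not-heavy (two , heavy) = no-special zs (lookup c (lookup ctx b₀))
              (two , ≤-trans (≤-reflexive (length-map (lookup ctx) (b₀ ∷ bs))) (≤-trans (m≤m+n _ (backDegree P)) deg≤)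
                   , uniq , heavy)
              (All.map proj₁ zs-K)
              (All.zipWith (λ (Kz , z~w) → two-colours (proj₂ Kz) (proj₂ Kw) (proj₂ (ctx-K b₀))
                  (proper (proj₁ Kz) (proj₁ Kw) z~w) (proper (proj₁ (ctx-K b₀)) (proj₁ Kw) (All.head adjs)))
                (zs-K , zs-adj))
            w∈ : w ∈ candidates S′ v ctx zs
            w∈ = ∈-candidates⁺ S′ v ctx zs not-heavy (x∈p∧x≢y⇒x∈p-y (proj₁ Kw) w≢v , fresh , zs-adj)
            next = extension-exists (w ∷ ctx) (s ∷ sides) P (≤-trans (m≤n+m _ (suc (length bs))) deg≤)
              (λ { zero → Kw ; (suc i) → ctx-K i }) (suc iv , v≡) (λ { zero → same ; (suc i) → coloured i }) real
            e = proj₁ next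
            e∈ = proj₁ (proj₂ next)
            forced = proj₂ (proj₂ next)

        pattern-cause : K v → ∀ P → backDegree P ≤ m → RealizedAt G K v P →
                        ∃[ e ] (e ∈ patternEvents S′ v P × Forced c e)
        pattern-cause Kv P deg≤ (y , x , Ky , Kx , v~y , y~x , x≢v , real)
          with extension-exists Kx Ky (Adj-sym G y~x) (x ∷ y ∷ v ∷ []) (true ∷ false ∷ true ∷ []) P deg≤
                 (λ { zero → Kx ; (suc zero) → Ky ; (suc (suc zero)) → Kv }) (suc (suc zero) , refl)
                 (λ { zero → refl ; (suc zero) → refl ; (suc (suc zero)) → v≡x }) real
          where
          v≡x : lookup c v ≡ lookup c x
          v≡x = two-colours (proj₂ Kv) (proj₂ Ky) (proj₂ Kx) (proper (proj₁ Kv) (proj₁ Ky) v~y)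
                  (proper (proj₁ Kx) (proj₁ Ky) (Adj-sym G y~x))
        ... | e , e∈ , forced = _
          , ∈-concatMap _ (∈-neighbours⁺ v~y) (∈-concatMap (pathExtensions S′ v P y)
              (∈-filter⁺ (λ x → ¬? (x ≟ᶠ v)) (∈-neighbours⁺ y~x) x≢v) (∈-map⁺ ((v , x) ∷_) e∈))
          , two-colours (proj₂ Kv) (proj₂ Ky) (proj₂ Kx) (proper (proj₁ Kv) (proj₁ Ky) v~y)
                  (proper (proj₁ Kx) (proj₁ Ky) (Adj-sym G y~x)) ∷ forced

        star-impossible : ∀ {H} → F H → (f : Vertex H → V) → Injective _≡_ _≡_ f →
                          (∀ {u w} → Adj H u w → Adj G (f u) (f w)) → (∀ u → K (f u)) → ∀ {h} → ¬ ¬ NonStar H h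
        star-impossible {H} FH f inj hom f-K {h} star = no-special zs (other (proj₂ (f-K h)))
          (subst (2 ≤_) (sym len) 2≤m , ≤-reflexive len , Unique.map⁺ inj (Unique.take⁺ m N-unique) , heavy)
          (All.map⁺ (All.tabulate λ _ → proj₁ (f-K _)))
          (All.map⁺ (All.map (λ {u} a → other-ok (proj₂ (f-K h)) (proj₂ (f-K u))
            (proper (proj₁ (f-K u)) (proj₁ (f-K h)) (Adj-sym G (hom a)))) N-adj))
          where
          N? = λ w → T? (adj H h w)
          N = filter N? (allFin (order H))
          N-unique : Unique N
          N-unique = Unique.filter⁺ N? (Unique.allFin⁺ _)
          N-adj : All (Adj H h) (take m N)
          N-adj = All.take⁺ m (All.all-filter N? (allFin (order H)))
          zs = map f (take m N)
          len : length zs ≡ m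
          len = trans (length-map f (take m N)) (trans (length-take m N) (m≤n⇒m⊓n≡m (star-neighbours FH star)))
          heavy : Heavy zs
          heavy = begin
            threshold (length zs) ≡⟨ cong threshold len ⟩
            threshold m ≤⟨ threshold-m ⟩
            1 ≡⟨ sym (𝟙-yes (All.map⁺ (All.map hom N-adj))) ⟩
            𝟙 (All (Adj G (f h)) zs) ≤⟨ ≤-∑ (λ p → 𝟙 (All (Adj G p) zs)) (∈-allFin (f h)) ⟩
            common zs ∎
            where open ≤-Reasoning
          other : ∀ {p} → p ≡ a ⊎ p ≡ b → Fin C
          other (inj₁ _) = b
          other (inj₂ _) = a
          other-ok : ∀ {p r} (p-ab : p ≡ a ⊎ p ≡ b) → r ≡ a ⊎ r ≡ b → r ≢ p → r ≡ other p-ab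
          other-ok (inj₁ refl) (inj₁ refl) r≢p = ⊥-elim (r≢p refl)
          other-ok (inj₁ refl) (inj₂ refl) _ = refl
          other-ok (inj₂ refl) (inj₁ refl) _ = refl
          other-ok (inj₂ refl) (inj₂ refl) r≢p = ⊥-elim (r≢p refl)

      cause : v ∈ₛ S → Violation S c → Cause
      cause v∈S (edge u∈ w∈ a eq) = edge-cause u∈ w∈ a eq
      cause v∈S (special zs a sp zs∈ mono) = special-cause zs a sp zs∈ mono
      cause v∈S (copy {a} {b} a≢b H FH f inj hom f-K) with em {Cause}
      ... | yes cs = cs
      ... | no ¬cs with em {∃[ h ] f h ≡ v}
      ...   | no v∉ = ⊥-elim (val (copy a≢b H FH f inj hom λ u →
                x∈p∧x≢y⇒x∈p-y (proj₁ (f-K u)) (λ eq → v∉ (u , eq)) , proj₂ (f-K u)))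
      -- The absence of a cause makes c proper and free of monochromatic special sets on S, not only
      -- on S - v. The pattern contains v, so both are needed on S.
      ...   | yes (h , refl) with covers FH (decidable-stable em
                (star-impossible v∈S (λ u∈ w∈ a eq → ¬cs (edge-cause u∈ w∈ a eq))
                  (λ zs a sp zs∈ mono → ¬cs (special-cause zs a sp zs∈ mono)) FH f inj hom f-K))
      ...     | wp , wp∈ , real = inj₂ (inj₂ (wp , wp∈ ,
                pattern-cause v∈S (λ u∈ w∈ a eq → ¬cs (edge-cause u∈ w∈ a eq))
                  (λ zs a sp zs∈ mono → ¬cs (special-cause zs a sp zs∈ mono)) (f-K h) (pattern′ wp) (backDegree≤ wp)
                  (RealizedAt-map H G f inj hom {K = Anywhere {H}} (λ {u} _ → f-K u) (pattern′ wp) real)))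

    module _ {x C : ℕ} .{{_ : NonZero β}} .{{_ : NonZero D}} (Δ≤x : Δ ^ m ≤ x ^ q) (x≤β : x ≤ β)
      (enough : D * β + D * Δ + q * (D * x) + ∑ Ps weight ≤ D * C) where

      edgeGroup : ∀ S v → Group β D S v
      edgeGroup S v = record
        { exponent = 0 ; weight = D * Δ ; events = edgeEvents S v ; events-at = edgeEvents-at S v
        ; few = ≤-trans (*-monoʳ-≤ D (≤-trans (≤-reflexive (length-map _ (neighbours v))) (G-degree v)))
                        (≤-reflexive (sym (*-identityʳ _))) }

      specialGroup : ∀ S v → Fin q → Group β D S v
      specialGroup S v i = record
        { exponent = toℕ i ; weight = D * x ; events = specialEvents S v (toℕ i) ; events-at = specialEvents-at S v (toℕ i)
        ; few = ≤-trans (*-monoʳ-≤ D (≤-trans (specialEvents-few S v Δ≤x (toℕ i) (toℕ<n i)) (*-monoʳ-≤ x (^-monoˡ-≤ (toℕ i) x≤β))))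
                        (≤-reflexive (sym (*-assoc D x _))) }

      patternGroup : ∀ S v → WeightedPattern q Δ β D → Group β D S v
      patternGroup S v wp = record
        { exponent = steps (pattern′ wp) ; weight = weight wp ; events = patternEvents S v (pattern′ wp)
        ; events-at = patternEvents-at S v (pattern′ wp)
        ; few = light wp _ (patternEvents-count S v (pattern′ wp) (backDegree≤ wp)) }

      groups : ∀ S v → List (Group β D S v)
      groups S v = edgeGroup S v ∷ map (specialGroup S v) (allFin q) ++ map (patternGroup S v) Ps

      groups-light : ∀ S v → ∑ (groups S v) Group.weight + D * β ≤ D * C
      groups-light S v = ≤-trans (≤-reflexive (begin
        D * Δ + ∑ (map (specialGroup S v) (allFin q) ++ map (patternGroup S v) Ps) Group.weight + D * β
          ≡⟨ cong (λ z → D * Δ + z + D * β) (trans (∑-++ (map (specialGroup S v) (allFin q)) _ Group.weight)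
               (cong₂ _+_ (trans (∑-map (specialGroup S v) (allFin q) Group.weight)
                             (trans (∑-const (allFin q) (D * x)) (cong (_* (D * x)) (length-allFin q))))
                          (∑-map (patternGroup S v) Ps Group.weight))) ⟩
        D * Δ + (q * (D * x) + ∑ Ps weight) + D * β
          ≡⟨ shuffle (D * Δ) (q * (D * x)) (∑ Ps weight) (D * β) ⟩
        D * β + D * Δ + q * (D * x) + ∑ Ps weight ∎)) enough
        where
        open ≡-Reasoning
        shuffle : ∀ a b c d → a + (b + c) + d ≡ d + a + b + c
        shuffle = solve-∀

      cover : ∀ S v → v ∈ₛ S → (c : Vec (Fin C) n) → Valid (S - v) c → ¬ Valid S c →
              ∃[ g ] (g ∈ groups (S - v) v × ∃[ e ] (e ∈ Group.events g × Forced c e))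
      cover S v v∈S c val ¬val with cause S v c val v∈S (decidable-stable em ¬val)
      ... | inj₁ found = edgeGroup (S - v) v , here refl , found
      ... | inj₂ (inj₁ (i , i<q , found)) = specialGroup (S - v) v (fromℕ< i<q)
          , there (∈-++⁺ˡ (∈-map⁺ (specialGroup (S - v) v) (∈-allFin (fromℕ< i<q))))
          , subst (λ i → ∃[ e ] (e ∈ specialEvents (S - v) v i × Forced c e)) (sym (toℕ-fromℕ< i<q)) found
      ... | inj₂ (inj₂ (wp , wp∈ , found)) = patternGroup (S - v) v wp
          , there (∈-++⁺ʳ (map (specialGroup (S - v) v) (allFin q)) (∈-map⁺ (patternGroup (S - v) v) wp∈)) , found

      private
        C-nonZero : NonZero C
        C-nonZero = >-nonZero (*-cancelˡ-< D 0 C (begin-strict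
          D * 0                                          ≡⟨ *-zeroʳ D ⟩
          0                                              <⟨ *-mono-< (>-nonZero⁻¹ D) (>-nonZero⁻¹ β) ⟩
          D * β                                          ≤⟨ m≤m+n (D * β) _ ⟩
          D * β + (D * Δ + (q * (D * x) + ∑ Ps weight))  ≡⟨ reassoc (D * β) (D * Δ) (q * (D * x)) (∑ Ps weight) ⟩
          D * β + D * Δ + q * (D * x) + ∑ Ps weight      ≤⟨ enough ⟩
          D * C                                          ∎))
          where
          open ≤-Reasoning
          reassoc : ∀ a b c d → a + (b + (c + d)) ≡ a + b + c + d
          reassoc = solve-∀

      colorable : Colorable F G C
      colorable = lookup c , record
        { proper = λ u v a eq → val (edge ∈⊤ ∈⊤ a eq)
        ; avoids = λ a b a≢b H FH (f , inj , hom , col) →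
            val (copy a≢b H FH f inj (λ {u} {v} → hom u v) (λ u → ∈⊤ , col u)) }
        where
        open Counting em {n} {C} {β} {D} {{C-nonZero}} Valid Valid-antitone Valid-local
        open Extend (λ S v _ → groups (S - v) v) (λ S v _ → groups-light (S - v) v) cover
        c = proj₁ (coloring-exists Valid-⊥)
        val = proj₂ (coloring-exists Valid-⊥)

-- The two families of patterns

-- The case e = m and k = s + 3: the exponent m(k-1) - e equals m(s+1).
count-≤ : ∀ q .{{_ : NonZero q}} {Δ x N} .{{_ : NonZero Δ}} → Δ ^ suc q ≤ x ^ q →
          ∀ s → N ^ q * Δ ^ suc q ≤ Δ ^ (suc q * (2 + s)) → N ≤ x ^ suc s
count-≤ q {Δ} {x} {N} Δ≤x s bound = ^-cancelˡ-≤ q (begin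
  N ^ q                    ≤⟨ *-cancelʳ-≤ _ _ (Δ ^ m) {{m^n≢0 Δ m}} (≤-trans bound (≤-reflexive
                               (trans (cong (Δ ^_) (*-suc m (suc s))) (trans (^-distribˡ-+-* Δ m (m * suc s)) (*-comm (Δ ^ m) _))))) ⟩
  Δ ^ (m * suc s)          ≡⟨ sym (^-*-assoc Δ m (suc s)) ⟩
  (Δ ^ m) ^ suc s          ≤⟨ ^-monoˡ-≤ (suc s) Δ≤x ⟩
  (x ^ q) ^ suc s          ≡⟨ ^-swap x q (suc s) ⟩
  (x ^ suc s) ^ q          ∎)
  where
  open ≤-Reasoning
  m = suc q

-- One edge more than in `count-≤` saves a factor y, and y^(m(s+1)-1) = y^(m-1) y^(ms), whose first
-- factor is Δ.
count-≤′ : ∀ q .{{_ : NonZero q}} {Δ x N} .{{_ : NonZero Δ}} → Δ ^ suc q ≤ x ^ q →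
           ∀ s → N ^ q * Δ ^ suc (suc q) ≤ Δ ^ (suc q * (2 + s)) → N ≤ Δ * x ^ s
count-≤′ q {Δ} {x} {N} Δ≤x s bound = ^-cancelˡ-≤ q (begin
  N ^ q                    ≤⟨ *-cancelʳ-≤ _ _ (Δ ^ suc m) {{m^n≢0 Δ (suc m)}} (≤-trans bound (≤-reflexive
                               (trans (cong (Δ ^_) (exponents q s)) (^-distribˡ-+-* Δ (q + m * s) (suc m))))) ⟩
  Δ ^ (q + m * s)          ≡⟨ ^-distribˡ-+-* Δ q (m * s) ⟩
  Δ ^ q * Δ ^ (m * s)      ≡⟨ cong (Δ ^ q *_) (sym (^-*-assoc Δ m s)) ⟩
  Δ ^ q * (Δ ^ m) ^ s      ≤⟨ *-monoʳ-≤ (Δ ^ q) (^-monoˡ-≤ s Δ≤x) ⟩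
  Δ ^ q * (x ^ q) ^ s      ≡⟨ cong (Δ ^ q *_) (^-swap x q s) ⟩
  Δ ^ q * (x ^ s) ^ q      ≡⟨ sym (^-distribʳ-* Δ (x ^ s) q) ⟩
  (Δ * x ^ s) ^ q          ∎)
  where
  open ≤-Reasoning
  m = suc q
  exponents : ∀ q s → suc q * (2 + s) ≡ q + suc q * s + suc (suc q)
  exponents = solve-∀

≅-hom : ∀ {G H} (iso : G ≅ H) {u v} → Adj H u v → Adj G (Inverse.from (_≅_.bijection iso) u) (Inverse.from (_≅_.bijection iso) v)
≅-hom {G} {H} iso {u} {v} = subst T (sym (trans (preserves _ _) (cong₂ (adj H) (strictlyInverseˡ u) (strictlyInverseˡ v))))
  where
  open _≅_ iso
  open Inverse bijection

RealizedAt-≅ : ∀ {G H} (iso : G ≅ H) {h} P → RealizedAt H (Anywhere {H}) (Inverse.to (_≅_.bijection iso) h) P →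
               RealizedAt G (Anywhere {G}) h P
RealizedAt-≅ {G} {H} iso {h} P real = subst (λ h → RealizedAt G (Anywhere {G}) h P) (strictlyInverseʳ h)
  (RealizedAt-map H G from from-inj (≅-hom iso) {K = Anywhere {H}} (λ _ → tt) P real)
  where
  open Inverse (_≅_.bijection iso)
  from-inj : Injective _≡_ _≡_ from
  from-inj {u} {v} eq = trans (sym (strictlyInverseˡ u)) (trans (cong to eq) (strictlyInverseˡ v))

NonStar-≅ : ∀ {G H} (iso : G ≅ H) {h} → NonStar G h → NonStar H (Inverse.to (_≅_.bijection iso) h)
NonStar-≅ {G} {H} iso = NonStar-map G H to to-inj λ {u} {v} → subst T (preserves u v)
  where
  open _≅_ iso
  open Inverse bijection
  to-inj : Injective _≡_ _≡_ to
  to-inj {u} {v} eq = trans (sym (strictlyInverseʳ u)) (trans (cong from eq) (strictlyInverseʳ v))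

module Representatives (em : ExcludedMiddle 0ℓ) {a Δ β D k B w : ℕ} (rep : Fin k → Graph)
  (rep-ok : ∀ i → Connected (rep i) × Bipartite (rep i) × 2 + a ≤ size (rep i))
  (rep-order : ∀ i → order (rep i) ≤ B)
  (light-at : ∀ i {h} P → backDegree P ≡ a → RealizedAt (rep i) (Anywhere {rep i}) h P →
           ∀ N → N ^ suc a * Δ ^ (2 + a) ≤ Δ ^ ((2 + a) * (2 + steps P)) → D * N ≤ w * β ^ steps P)
  where
  open WeightedPattern

  private
    Suitable : ∀ i → Vertex (rep i) → Set
    Suitable i h = ∃[ P ] (backDegree P ≡ a × RealizedAt (rep i) (Anywhere {rep i}) h P)

    weighted : ∀ i {h} → Suitable i h → WeightedPattern (suc a) Δ β D
    weighted i (P , deg , real) = record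
      { pattern′ = P ; weight = w
      ; backDegree≤ = ≤-trans (≤-reflexive deg) (m≤n+m a 2)
      ; light = λ N b → light-at i P deg real N (subst (λ d → N ^ suc a * Δ ^ (2 + d) ≤ Δ ^ ((2 + a) * (2 + steps P))) deg b) }

    pick : ∀ i (h : Vertex (rep i)) → List (WeightedPattern (suc a) Δ β D)
    pick i h with em {Suitable i h}
    ... | yes s = weighted i s ∷ []
    ... | no _  = []

    pick-weight : ∀ i h → ∑ (pick i h) weight ≤ w
    pick-weight i h with em {Suitable i h}
    ... | yes _ = ≤-reflexive (+-identityʳ w)
    ... | no _  = z≤n

    pick-covers : ∀ i h → NonStar (rep i) h → ∃[ wp ] (wp ∈ pick i h × RealizedAt (rep i) (Anywhere {rep i}) h (pattern′ wp))
    pick-covers i h ns with em {Suitable i h}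
    ... | yes s@(_ , _ , real) = weighted i s , here refl , real
    ... | no ¬s = let conn , bip , big = rep-ok i in
      ⊥-elim (¬s (Exploration.patternAt em (rep i) conn bip ns a big))

    picks : Fin k → List (WeightedPattern (suc a) Δ β D)
    picks i = concatMap (pick i) (allFin (order (rep i)))

  -- One pattern is chosen for each vertex of each representative and transported along
  -- isomorphisms, so that a whole class is charged once per vertex.
  representativePatterns : List (WeightedPattern (suc a) Δ β D)
  representativePatterns = concatMap picks (allFin k)

  representativePatterns-weight : ∑ representativePatterns weight ≤ k * (B * w)
  representativePatterns-weight = begin
    ∑ representativePatterns weight                 ≡⟨ ∑-concatMap picks (allFin k) weight ⟩
    ∑ (allFin k) (λ i → ∑ (picks i) weight)         ≤⟨ ∑-≤ (allFin k) (λ {i} _ → begin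
      ∑ (picks i) weight                                       ≡⟨ ∑-concatMap (pick i) (allFin (order (rep i))) weight ⟩
      ∑ (allFin (order (rep i))) (λ h → ∑ (pick i h) weight)   ≤⟨ ∑-≤ (allFin (order (rep i))) (λ {h} _ → pick-weight i h) ⟩
      length (allFin (order (rep i))) * w                      ≡⟨ cong (_* w) (length-allFin (order (rep i))) ⟩
      order (rep i) * w                                        ≤⟨ *-monoˡ-≤ w (rep-order i) ⟩
      B * w                                                    ∎) ⟩
    length (allFin k) * (B * w)                     ≡⟨ cong (_* (B * w)) (length-allFin k) ⟩
    k * (B * w)                                     ∎
    where open ≤-Reasoning

  representativePatterns-cover : ∀ {H} i → H ≅ rep i → ∀ {h} → NonStar H h →
    ∃[ wp ] (wp ∈ representativePatterns × RealizedAt H (Anywhere {H}) h (pattern′ wp))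
  representativePatterns-cover i iso ns with pick-covers i _ (NonStar-≅ iso ns)
  ... | wp , wp∈ , real = wp , ∈-concatMap picks (∈-allFin i) (∈-concatMap (pick i) (∈-allFin _) wp∈)
                             , RealizedAt-≅ iso (pattern′ wp) real

∑-map-vecs : ∀ {L} (f : Vec A L → B) (g : B → ℕ) w → (∀ v → g (f v) ≡ w) → ∀ xs →
             ∑ (map f (vecs xs L)) g ≡ length xs ^ L * w
∑-map-vecs {L = L} f g w const xs = begin
  ∑ (map f (vecs xs L)) g   ≡⟨ ∑-map f (vecs xs L) g ⟩
  ∑ (vecs xs L) (g ∘ f)     ≡⟨ ∑-cong (vecs xs L) const ⟩
  ∑ (vecs xs L) (λ _ → w)   ≡⟨ ∑-const (vecs xs L) w ⟩
  length (vecs xs L) * w    ≡⟨ cong (_* w) (length-vecs xs L) ⟩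
  length xs ^ L * w         ∎
  where open ≡-Reasoning

module Bounds (em : ExcludedMiddle 0ℓ) (a : ℕ) (F : Family)
  (F-ok : ∀ H → F H → Connected H × Bipartite H × 2 + a ≤ size H) where
  open WeightedPattern

  private
    q m : ℕ
    q = suc a
    m = suc q

    F-ok′ : ∀ {H} → F H → Connected H × m ≤ size H
    F-ok′ FH = let conn , _ , big = F-ok _ FH in conn , big

  UniformlyColorable : ℕ → ℕ → Set
  UniformlyColorable Δ C = ∀ G → MaxDegree≤ G Δ → Colorable F G C

  IntegerRoot : ℕ → ℕ → Set
  IntegerRoot Δ h = h ^ q ≤ Δ ^ m × Δ ^ m < suc h ^ q

  Δ≤integerRoot : ∀ {Δ h} .{{_ : NonZero Δ}} → IntegerRoot Δ h → Δ ≤ h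
  Δ≤integerRoot {Δ} (_ , upper) = ≤-pred (^-cancelˡ-< q (≤-<-trans (^-monoʳ-≤ Δ (n≤1+n q)) upper))

  module SmallOrder (k : ℕ) (number : NumberUpToIso (λ H → F H × order H ≤ m) k) (Δ : ℕ) .{{_ : NonZero Δ}}
    (H₀ : ℕ) .{{_ : NonZero H₀}} (H₀-root : IntegerRoot Δ H₀) where
    private
      rep = proj₁ number
      -- 2H₀ is at least H₀ + 1, hence above y^m. With β = 4x a pattern with m edges and s steps
      -- costs x / 4^s. The 4^(a+1) trees have a steps each and cost 4x together; D = 4^a makes
      -- their weights integral.
      x β D : ℕ
      x = 2 * H₀
      β = 4 * x
      D = 4 ^ a

      Δ≤x : Δ ^ m ≤ x ^ q
      Δ≤x = <⇒≤ (<-≤-trans (proj₂ H₀-root) (^-monoˡ-≤ q (≤-trans (+-monoˡ-≤ H₀ (>-nonZero⁻¹ H₀)) (≤-reflexive (double H₀)))))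
        where
        double : ∀ h → h + h ≡ 2 * h
        double = solve-∀

      -- One step suffices to bring the cost 2H₀ / 4^s below H₀. Without any step the edge budget a
      -- would be 0, that is m = 2, but the initial path already has three vertices.
      positive : ∀ i {h} P → backDegree P ≡ a → RealizedAt (rep i) (Anywhere {rep i}) h P → 1 ≤ steps P
      positive i (extend _ _ _) _ _ = s≤s z≤n
      positive i {h} done refl (y , x , _ , _ , hy , yx , x≢h , _) =
        ⊥-elim (<⇒≱ (Unique-⊆-length {ys = allFin (order (rep i))}
            ((Adj-≢ (rep i) hy ∷ (x≢h ∘ sym) ∷ []) ∷ (Adj-≢ (rep i) yx ∷ []) ∷ [] ∷ []) (λ _ → ∈-allFin _))
          (≤-trans (≤-reflexive (length-allFin (order (rep i)))) (proj₂ (proj₁ (proj₂ number) i))))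
      light′ : ∀ i {h} P → backDegree P ≡ a → RealizedAt (rep i) (Anywhere {rep i}) h P →
               ∀ N → N ^ q * Δ ^ m ≤ Δ ^ (m * (2 + steps P)) → D * N ≤ D * H₀ * β ^ steps P
      light′ i P deg real N bound = begin
        D * N                          ≤⟨ *-monoʳ-≤ D (count-≤ q {Δ} {x} Δ≤x (steps P) bound) ⟩
        D * (2 * H₀ * x ^ s)           ≡⟨ shuffle D H₀ (x ^ s) ⟩
        D * H₀ * (2 * x ^ s)           ≤⟨ *-monoʳ-≤ (D * H₀) (*-monoˡ-≤ (x ^ s) (2≤4^ s (positive i P deg real))) ⟩
        D * H₀ * (4 ^ s * x ^ s)       ≡⟨ cong (D * H₀ *_) (sym (^-distribʳ-* 4 x s)) ⟩
        D * H₀ * β ^ s                 ∎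
        where
        open ≤-Reasoning
        s = steps P
        2≤4^ : ∀ s → 1 ≤ s → 2 ≤ 4 ^ s
        2≤4^ (suc s) _ = *-mono-≤ {2} {4} {1} (s≤s (s≤s z≤n)) (m^n>0 4 s)
        shuffle : ∀ d h p → d * (2 * h * p) ≡ d * h * (2 * p)
        shuffle = solve-∀

      open module Reps = Representatives em {a} {Δ} {β} {D} {k} {m} {D * H₀} rep
        (λ i → F-ok _ (proj₁ (proj₁ (proj₂ number) i))) (λ i → proj₂ (proj₁ (proj₂ number) i)) light′

      tree : Vec Bool (2 + 2 * a) → WeightedPattern q Δ β D
      tree bits = record
        { pattern′ = P ; weight = x
        ; backDegree≤ = ≤-trans (≤-reflexive deg) (m≤n+m a 2)
        ; light = λ N bound → begin
            D * N               ≤⟨ *-monoʳ-≤ D (count-≤ q {Δ} {x} Δ≤x a (subst (λ d → N ^ q * Δ ^ (2 + d) ≤ Δ ^ (m * (2 + a))) deg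
                                     (subst (λ s → N ^ q * Δ ^ (2 + backDegree P) ≤ Δ ^ (m * (2 + s))) st bound))) ⟩
            D * (x * x ^ a)     ≡⟨ shuffle D x (x ^ a) ⟩
            x * (D * x ^ a)     ≡⟨ cong (x *_) (sym (^-distribʳ-* 4 x a)) ⟩
            x * β ^ a           ≡⟨ cong (λ s → x * β ^ s) (sym st) ⟩
            x * β ^ steps P     ∎ }
        where
        open ≤-Reasoning
        P = treePattern a (suc (suc zero)) bits
        deg = backDegree-treePattern a (suc (suc zero)) bits
        st = steps-treePattern a (suc (suc zero)) bits
        shuffle : ∀ d x y → d * (x * y) ≡ x * (d * y)
        shuffle = solve-∀

      bools : List Bool
      bools = false ∷ true ∷ []

      trees : List (WeightedPattern q Δ β D)
      trees = map tree (vecs bools (2 + 2 * a))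

      trees-weight : ∑ trees weight ≡ D * (4 * x)
      trees-weight = begin
        ∑ trees weight                 ≡⟨ ∑-map-vecs tree weight x (λ _ → refl) bools ⟩
        2 ^ (2 + 2 * a) * x            ≡⟨ cong (_* x) (trans (^-distribˡ-+-* 2 2 (2 * a)) (cong (4 *_) (sym (^-*-assoc 2 2 a)))) ⟩
        4 * D * x                      ≡⟨ shuffle D x ⟩
        D * (4 * x)                    ∎
        where
        open ≡-Reasoning
        shuffle : ∀ d x → 4 * d * x ≡ d * (4 * x)
        shuffle = solve-∀

      Ps = representativePatterns ++ trees

      covers : ∀ {H} → F H → ∀ {h} → NonStar H h → ∃[ wp ] (wp ∈ Ps × RealizedAt H (Anywhere {H}) h (pattern′ wp))
      covers {H} FH ns with order H ≤? m
      ... | yes small = let i , iso = proj₂ (proj₂ (proj₂ number)) H (FH , small)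
                            wp , wp∈ , real = representativePatterns-cover i iso ns
                        in wp , ∈-++⁺ˡ wp∈ , real
      ... | no large = let bits , real = Exploration.treePatternAt em H (proj₁ (F-ok′ FH)) ns a (≰⇒> large)
                       in tree bits , ∈-++⁺ʳ representativePatterns (∈-map⁺ tree (∈-vecs all bits)) , real
        where
        all : ∀ b → b ∈ bools
        all false = here refl
        all true  = there (here refl)

    colours : ℕ
    colours = β + Δ + q * x + k * (m * H₀) + 4 * x

    uniformlyColorable : UniformlyColorable Δ colours
    uniformlyColorable G G-degree =
      Colouring.colorable em q F F-ok′ Δ G G-degree {β} {D} Ps covers {{nz-β}} {{m^n≢0 4 a}} Δ≤x (m≤m+n x _) (begin
        D * β + D * Δ + q * (D * x) + ∑ Ps weight
          ≡⟨ cong (D * β + D * Δ + q * (D * x) +_)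
               (trans (∑-++ representativePatterns trees weight) (cong (∑ representativePatterns weight +_) trees-weight)) ⟩
        D * β + D * Δ + q * (D * x) + (∑ representativePatterns weight + D * (4 * x))
          ≤⟨ +-monoʳ-≤ (D * β + D * Δ + q * (D * x)) (+-monoˡ-≤ (D * (4 * x)) representativePatterns-weight) ⟩
        D * β + D * Δ + q * (D * x) + (k * (m * (D * H₀)) + D * (4 * x))
          ≡⟨ collect D β Δ q x k m H₀ ⟩
        D * colours ∎)
      where
      open ≤-Reasoning
      nz-β : NonZero β
      nz-β = m*n≢0 4 x {{_}} {{m*n≢0 2 H₀}}
      collect : ∀ d b e q x k m h → d * b + d * e + q * (d * x) + (k * (m * (d * h)) + d * (4 * x))
                                  ≡ d * (b + e + q * x + k * (m * h) + 4 * x)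
      collect = solve-∀

    -- In units of H₀, β and the trees contribute 8 each and the edges at v at most 1, as Δ is at
    -- most H₀; this is the 17 in the calculation. The special sets add 2q.
    colours-< : colours < (k + 71) * (m + 1) * H₀
    colours-< = begin-strict
      colours
        ≤⟨ +-monoˡ-≤ (4 * x) (+-monoˡ-≤ (k * (m * H₀)) (+-monoˡ-≤ (q * x) (+-monoʳ-≤ β (Δ≤integerRoot H₀-root)))) ⟩
      4 * (2 * H₀) + H₀ + q * (2 * H₀) + k * (m * H₀) + 4 * (2 * H₀)
        ≡⟨ collect k m q H₀ ⟩
      (k * m + (17 + q * 2)) * H₀
        <⟨ *-monoˡ-< H₀ (+-mono-≤-< (*-monoʳ-≤ k (m≤m+n m 1)) (begin-strict
             17 + q * 2                 ≤⟨ +-mono-≤ (*-monoʳ-≤ 17 (s≤s (z≤n {m}))) (≤-reflexive (*-comm q 2)) ⟩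
             17 * suc m + 2 * q         ≤⟨ +-monoʳ-≤ (17 * suc m) (*-monoʳ-≤ 2 (≤-trans (n≤1+n q) (n≤1+n m))) ⟩
             17 * suc m + 2 * suc m     ≡⟨ sym (*-distribʳ-+ (suc m) 17 2) ⟩
             19 * suc m                 <⟨ *-monoˡ-< (suc m) (toWitness {a? = 19 <? 71} tt) ⟩
             71 * suc m                 ≡⟨ cong (71 *_) (+-comm 1 m) ⟩
             71 * (m + 1)               ∎)) ⟩
      (k * (m + 1) + 71 * (m + 1)) * H₀
        ≡⟨ cong (_* H₀) (sym (*-distribʳ-+ (m + 1) k 71)) ⟩
      (k + 71) * (m + 1) * H₀ ∎
      where
      open ≤-Reasoning
      collect : ∀ k m q h → 4 * (2 * h) + h + q * (2 * h) + k * (m * h) + 4 * (2 * h) ≡ (k * m + (17 + q * 2)) * h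
      collect = solve-∀

  module ExactSize (k : ℕ) (number : NumberUpToIso (λ H → F H × size H ≡ m) k) where

    -- An upper bound, depending on m alone, for the number of patterns that have m + 1 edges
    -- together with the initial path. Each costs only Δ, so a crude count is enough.
    excess : ℕ
    excess = length (patterns {3} (suc a) (suc a))

    module _ (Δ : ℕ) .{{_ : NonZero Δ}} (H₀ : ℕ) .{{_ : NonZero H₀}} (H₀-root : IntegerRoot Δ H₀) where
      private
        rep = proj₁ number
        x : ℕ
        x = suc H₀

        Δ≤x : Δ ^ m ≤ x ^ q
        Δ≤x = <⇒≤ (proj₂ H₀-root)

        rep-F : ∀ i → F (rep i)
        rep-F i = proj₁ (proj₁ (proj₂ number) i)

        rep-size : ∀ i → size (rep i) ≡ m
        rep-size i = proj₂ (proj₁ (proj₂ number) i)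

        rep-order : ∀ i → order (rep i) ≤ suc m
        rep-order i = ≤-trans (Exploration.order≤1+size em (rep i) (proj₁ (F-ok′ (rep-F i)))) (≤-reflexive (cong suc (rep-size i)))

        open module Reps = Representatives em {a} {Δ} {x} {1} {k} {suc m} {x} rep (λ i → F-ok _ (rep-F i)) rep-order
          (λ i P deg real N bound → ≤-trans (≤-reflexive (*-identityˡ N)) (count-≤ q {Δ} {x} Δ≤x (steps P) bound))

        largePattern : ∀ P → backDegree P ≡ suc a → WeightedPattern q Δ x 1
        largePattern P deg = record
          { pattern′ = P ; weight = Δ ; backDegree≤ = ≤-trans (≤-reflexive deg) (n≤1+n (suc a))
          ; light = λ N bound → ≤-trans (≤-reflexive (*-identityˡ N)) (count-≤′ q {Δ} {x} Δ≤x (steps P)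
                      (subst (λ d → N ^ q * Δ ^ (2 + d) ≤ Δ ^ (m * (2 + steps P))) deg bound)) }

        ofDegree : Pattern 3 → List (WeightedPattern q Δ x 1)
        ofDegree P with backDegree P ≟ suc a
        ... | yes deg = largePattern P deg ∷ []
        ... | no _    = []

        ofDegree-weight : ∀ P → ∑ (ofDegree P) weight ≤ Δ
        ofDegree-weight P with backDegree P ≟ suc a
        ... | yes _ = ≤-reflexive (+-identityʳ Δ)
        ... | no _  = z≤n

        ofDegree-∈ : ∀ P → backDegree P ≡ suc a → ∃[ wp ] (wp ∈ ofDegree P × pattern′ wp ≡ P)
        ofDegree-∈ P deg with backDegree P ≟ suc a
        ... | yes deg′ = largePattern P deg′ , here refl , refl
        ... | no ¬deg  = ⊥-elim (¬deg deg)

        largePatterns : List (WeightedPattern q Δ x 1)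
        largePatterns = concatMap ofDegree (patterns (suc a) (suc a))

        largePatterns-weight : ∑ largePatterns weight ≤ excess * Δ
        largePatterns-weight = ≤-trans (≤-reflexive (∑-concatMap ofDegree (patterns (suc a) (suc a)) weight))
          (∑-≤ (patterns (suc a) (suc a)) λ {P} _ → ofDegree-weight P)

        Ps = representativePatterns ++ largePatterns

        covers : ∀ {H} → F H → ∀ {h} → NonStar H h → ∃[ wp ] (wp ∈ Ps × RealizedAt H (Anywhere {H}) h (pattern′ wp))
        covers {H} FH {h} ns with size H ≟ m
        ... | yes exact = let i , iso = proj₂ (proj₂ (proj₂ number)) H (FH , exact)
                              wp , wp∈ , real = representativePatterns-cover i iso ns
                          in wp , ∈-++⁺ˡ wp∈ , real
        ... | no inexact with Exploration.patternAt em H (proj₁ (F-ok _ FH)) (proj₁ (proj₂ (F-ok _ FH))) ns (suc a)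
                                (≤∧≢⇒< (proj₂ (F-ok′ FH)) (inexact ∘ sym))
        ...   | P , deg , real with ofDegree-∈ P deg
        ...     | wp , wp∈ , refl = wp , ∈-++⁺ʳ representativePatterns (∈-concatMap ofDegree P∈ wp∈) , real
          where
          P∈ : P ∈ patterns (suc a) (suc a)
          P∈ = ∈-patterns P (≤-reflexive deg) (≤-trans (steps≤backDegree P) (≤-reflexive deg))

      colours : ℕ
      colours = x + Δ + q * x + k * (suc m * x) + excess * Δ

      uniformlyColorable : UniformlyColorable Δ colours
      uniformlyColorable G G-degree =
        Colouring.colorable em q F F-ok′ Δ G G-degree {x} {1} Ps covers Δ≤x ≤-refl (begin
          1 * x + 1 * Δ + q * (1 * x) + ∑ Ps weight
            ≡⟨ cong₂ _+_ (cong₂ _+_ (cong₂ _+_ (*-identityˡ x) (*-identityˡ Δ)) (cong (q *_) (*-identityˡ x)))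
                         (∑-++ representativePatterns largePatterns weight) ⟩
          x + Δ + q * x + (∑ representativePatterns weight + ∑ largePatterns weight)
            ≤⟨ +-monoʳ-≤ (x + Δ + q * x) (+-mono-≤ representativePatterns-weight largePatterns-weight) ⟩
          x + Δ + q * x + (k * (suc m * x) + excess * Δ)
            ≡⟨ sym (+-assoc (x + Δ + q * x) _ _) ⟩
          colours
            ≡⟨ sym (*-identityˡ colours) ⟩
          1 * colours ∎)
        where open ≤-Reasoning

      -- Here g is an integer at most y. As Δ y = y^m, the product Δ g is at most H₀, so the terms
      -- in Δ and the rounding of x contribute only multiples of H₀ / g. The coefficient of x is m +
      -- k(m+1), one less than (k+1)(m+1).
      colours-< : ∀ {g} .{{_ : NonZero g}} → g ^ q ≤ Δ →
                  colours * g < H₀ * ((k + 1) * (m + 1) * g + (suc (k + 1) * (m + 1) + excess))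
      colours-< {g} g-root = begin-strict
        colours * g
          ≡⟨ expand H₀ Δ q k (suc m) excess g ⟩
        (m + k * suc m) * (H₀ * g) + (m + k * suc m) * g + (1 + excess) * (Δ * g)
          ≤⟨ +-mono-≤ (+-monoʳ-≤ ((m + k * suc m) * (H₀ * g)) (*-monoʳ-≤ (m + k * suc m) g≤H₀)) (*-monoʳ-≤ (1 + excess) Δg≤H₀) ⟩
        (m + k * suc m) * (H₀ * g) + (m + k * suc m) * H₀ + (1 + excess) * H₀
          <⟨ m<m+n _ {H₀ * g + m * H₀ + H₀} (≤-trans (>-nonZero⁻¹ H₀) (m≤n+m H₀ _)) ⟩
        (m + k * suc m) * (H₀ * g) + (m + k * suc m) * H₀ + (1 + excess) * H₀ + (H₀ * g + m * H₀ + H₀)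
          ≡⟨ collect H₀ m k excess g ⟩
        H₀ * ((k + 1) * (m + 1) * g + (suc (k + 1) * (m + 1) + excess)) ∎
        where
        open ≤-Reasoning
        Δg≤H₀ : Δ * g ≤ H₀
        Δg≤H₀ = ≤-pred (^-cancelˡ-< q (≤-<-trans (≤-trans (≤-reflexive (^-distribʳ-* Δ g q))
          (≤-trans (*-monoʳ-≤ (Δ ^ q) g-root) (≤-reflexive (*-comm (Δ ^ q) Δ)))) (proj₂ H₀-root)))
        g≤H₀ : g ≤ H₀
        g≤H₀ = ≤-trans (m≤n*m g Δ) Δg≤H₀
        expand : ∀ h d q k s e g → (suc h + d + q * suc h + k * (s * suc h) + e * d) * g
                                   ≡ (suc q + k * s) * (h * g) + (suc q + k * s) * g + (1 + e) * (d * g)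
        expand = solve-∀
        collect : ∀ h m k e g → (m + k * suc m) * (h * g) + (m + k * suc m) * h + (1 + e) * h + (h * g + m * h + h)
                                ≡ h * ((k + 1) * (m + 1) * g + (suc (k + 1) * (m + 1) + e))
        collect = solve-∀

-- Chromatic numbers and rational bounds

module Extremal (em : ExcludedMiddle 0ℓ) where

  least : ∀ (P : ℕ → Set) N → P N → ∃[ c ] (P c × (∀ c′ → P c′ → c ≤ c′))
  least P zero    P0 = 0 , P0 , λ _ _ → z≤n
  least P (suc N) PN with em {P 0}
  ... | yes P0 = 0 , P0 , λ _ _ → z≤n
  ... | no ¬P0 with least (P ∘ suc) N PN
  ...   | c , Pc , below = suc c , Pc , λ { zero P0 → ⊥-elim (¬P0 P0) ; (suc c′) Pc′ → s≤s (below c′ Pc′) }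

  greatest : ∀ (P : ℕ → Set) N → (∀ c → P c → c ≤ N) → ∀ {c₀} → P c₀ → ∃[ c ] (P c × (∀ c′ → P c′ → c′ ≤ c))
  greatest P N bound P₀ with em {P N}
  ... | yes PN = N , PN , bound
  greatest P zero bound P₀ | no ¬PN = ⊥-elim (¬PN (subst P (n≤0⇒n≡0 (bound _ P₀)) P₀))
  greatest P (suc N) bound P₀ | no ¬PN =
    greatest P N (λ c Pc → ≤-pred (≤∧≢⇒< (bound c Pc) λ { refl → ¬PN Pc })) P₀

  -- Infinitely many graphs compete, but their chromatic numbers form a set of naturals that is
  -- bounded by C and nonempty because of the empty graph.
  maxChromaticNumber : ∀ F Δ {C} → (∀ G → MaxDegree≤ G Δ → Colorable F G C) → ∃[ M ] IsMaxChromaticNumber F Δ M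
  maxChromaticNumber F Δ {C} colorable = M , record
    { attained = attained ; upperBound = λ G deg → let c , isχ , _ = chromatic G deg in c , isχ , maximal c (G , deg , isχ) }
    where
    chromatic : ∀ G → MaxDegree≤ G Δ → ∃[ c ] (IsChromaticNumber F G c × c ≤ C)
    chromatic G deg = let c , col , minimal = least (Colorable F G) C (colorable G deg)
                      in c , (col , minimal) , minimal C (colorable G deg)
    emptyGraph : Graph
    emptyGraph = record { order = 0 ; adj = λ () ; symm = λ () ; irrefl = λ () }
    Attained : ℕ → Set
    Attained c = ∃[ G ] (MaxDegree≤ G Δ × IsChromaticNumber F G c)
    extremal = greatest Attained C (λ c (G , deg , isχ) → proj₂ isχ C (colorable G deg))
                 (emptyGraph , (λ ()) , proj₁ (proj₂ (chromatic emptyGraph λ ())))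
    M = proj₁ extremal
    attained = proj₁ (proj₂ extremal)
    maximal = proj₂ (proj₂ extremal)

maxChromaticNumber-≤ : ∀ {F Δ M C} → IsMaxChromaticNumber F Δ M → (∀ G → MaxDegree≤ G Δ → Colorable F G C) → M ≤ C
maxChromaticNumber-≤ {C = C} isMax colorable =
  let G , deg , _ , minimal = IsMaxChromaticNumber.attained isMax in minimal C (colorable G deg)

fromℕ-* : ∀ a b → fromℕ (a * b) ≡ fromℕ a ℚ.* fromℕ b
fromℕ-* a b = ℚ.toℚᵘ-injective (ℚᵘ.≃-trans
  (*≡* (cong (ℤ._* ℤ.+ 1) (ℤ.pos-* a b))) (ℚᵘ.≃-sym (ℚ.toℚᵘ-homo-* (fromℕ a) (fromℕ b))))

fromℕ-+ : ∀ a b → fromℕ (a + b) ≡ fromℕ a ℚ.+ fromℕ b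
fromℕ-+ a b = ℚ.toℚᵘ-injective (ℚᵘ.≃-trans
  (*≡* (cong (ℤ._* ℤ.+ 1) (trans (ℤ.pos-+ a b) (sym (cong₂ ℤ._+_ (ℤ.*-identityʳ (ℤ.+ a)) (ℤ.*-identityʳ (ℤ.+ b)))))))
  (ℚᵘ.≃-sym (ℚ.toℚᵘ-homo-+ (fromℕ a) (fromℕ b))))

fromℕ-^ : ∀ a n → fromℕ (a ^ n) ≡ fromℕ a ^ℚ n
fromℕ-^ a zero    = refl
fromℕ-^ a (suc n) = trans (fromℕ-* a (a ^ n)) (cong (fromℕ a ℚ.*_) (fromℕ-^ a n))

fromℕ-< : ∀ {a b} → a < b → fromℕ a ℚ.< fromℕ b
fromℕ-< a<b = ℚ.toℚᵘ-cancel-< (*<* (ℤ.*-monoʳ-<-pos (ℤ.+ 1) (ℤ.+<+ a<b)))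

0≤fromℕ : ∀ n → 0ℚ ℚ.≤ fromℕ n
0≤fromℕ n = ℚ.nonNegative⁻¹ (fromℕ n)

^ℚ-distrib-* : ∀ p r n → (p ℚ.* r) ^ℚ n ≡ (p ^ℚ n) ℚ.* (r ^ℚ n)
^ℚ-distrib-* p r zero    = refl
^ℚ-distrib-* p r (suc n) = trans (cong (p ℚ.* r ℚ.*_) (^ℚ-distrib-* p r n)) (*-interchange p r (p ^ℚ n) (r ^ℚ n))

-- Here r g = M clears the denominator of r.
<·^-intro : ∀ q .{{_ : NonZero q}} {c g h M Δ r} .{{_ : NonZero g}} → r ℚ.* fromℕ g ≡ fromℕ M →
            h ^ q ≤ Δ ^ suc q → c * g < h * M → c < r · Δ ^⟨ suc q / q ⟩
<·^-intro q {c} {suc g} {h} {M} {Δ} {r} rg≡M h≤Δ c<hM = nonneg , ℚ.*-cancelʳ-<-nonNeg (fromℕ (suc g ^ q)) {{_}} (begin-strict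
  fromℕ c ^ℚ q ℚ.* fromℕ (suc g ^ q)                        ≡⟨ cong (ℚ._* fromℕ (suc g ^ q)) (sym (fromℕ-^ c q)) ⟩
  fromℕ (c ^ q) ℚ.* fromℕ (suc g ^ q)                       ≡⟨ sym (fromℕ-* (c ^ q) (suc g ^ q)) ⟩
  fromℕ (c ^ q * suc g ^ q)                                 <⟨ fromℕ-< natural ⟩
  fromℕ (M ^ q * Δ ^ suc q)                                 ≡⟨ trans (fromℕ-* (M ^ q) (Δ ^ suc q))
                                                                   (cong₂ ℚ._*_ (fromℕ-^ M q) (fromℕ-^ Δ (suc q))) ⟩
  fromℕ M ^ℚ q ℚ.* fromℕ Δ ^ℚ suc q                         ≡⟨ cong (λ z → z ^ℚ q ℚ.* fromℕ Δ ^ℚ suc q) (sym rg≡M) ⟩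
  (r ℚ.* fromℕ (suc g)) ^ℚ q ℚ.* fromℕ Δ ^ℚ suc q           ≡⟨ cong (ℚ._* fromℕ Δ ^ℚ suc q) (^ℚ-distrib-* r (fromℕ (suc g)) q) ⟩
  (r ^ℚ q) ℚ.* fromℕ (suc g) ^ℚ q ℚ.* fromℕ Δ ^ℚ suc q      ≡⟨ xy∙z≈xz∙y (r ^ℚ q) (fromℕ (suc g) ^ℚ q) (fromℕ Δ ^ℚ suc q) ⟩
  (r ^ℚ q) ℚ.* fromℕ Δ ^ℚ suc q ℚ.* fromℕ (suc g) ^ℚ q      ≡⟨ cong ((r ^ℚ q) ℚ.* fromℕ Δ ^ℚ suc q ℚ.*_) (sym (fromℕ-^ (suc g) q)) ⟩
  (r ^ℚ q) ℚ.* fromℕ Δ ^ℚ suc q ℚ.* fromℕ (suc g ^ q)       ∎)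
  where
  open ℚ.≤-Reasoning
  nonneg : 0ℚ ℚ.≤ r
  nonneg = ℚ.*-cancelʳ-≤-pos (fromℕ (suc g)) (begin
    0ℚ ℚ.* fromℕ (suc g)  ≡⟨ ℚ.*-zeroˡ (fromℕ (suc g)) ⟩
    0ℚ                    ≤⟨ 0≤fromℕ M ⟩
    fromℕ M               ≡⟨ sym rg≡M ⟩
    r ℚ.* fromℕ (suc g)   ∎)
  natural : c ^ q * suc g ^ q < M ^ q * Δ ^ suc q
  natural = <-≤-trans (subst₂ _<_ (^-distribʳ-* c (suc g) q) (trans (^-distribʳ-* h M q) (*-comm (h ^ q) (M ^ q))) (^-monoˡ-< q c<hM))
                      (*-monoʳ-≤ (M ^ q) h≤Δ)

fraction : ℕ → ℕ → ℚ
fraction a g = fromℚᵘ (mkℚᵘ (ℤ.+ a) g)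

fraction-* : ∀ a g → fraction a g ℚ.* fromℕ (suc g) ≡ fromℕ a
fraction-* a g = ℚ.toℚᵘ-injective (ℚᵘ.≃-trans (ℚ.toℚᵘ-homo-* (fraction a g) (fromℕ (suc g)))
  (ℚᵘ.≃-trans (ℚᵘ.*-congʳ {toℚᵘ (fromℕ (suc g))} (ℚ.toℚᵘ-fromℚᵘ (mkℚᵘ (ℤ.+ a) g)))
    (*≡* (trans (ℤ.*-identityʳ _) (cong (λ z → ℤ.+ a ℤ.* ℤ.+ suc z) (sym (*-identityʳ g)))))))

clear-denominator : ∀ k a g s → (fromℕ k ℚ.+ fraction a g) ℚ.* fromℕ s ℚ.* fromℕ (suc g) ≡ fromℕ (k * s * suc g + a * s)
clear-denominator k a g s = begin
  (K ℚ.+ o) ℚ.* S ℚ.* N                ≡⟨ cong (ℚ._* N) (ℚ.*-distribʳ-+ S K o) ⟩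
  (K ℚ.* S ℚ.+ o ℚ.* S) ℚ.* N          ≡⟨ ℚ.*-distribʳ-+ N (K ℚ.* S) (o ℚ.* S) ⟩
  K ℚ.* S ℚ.* N ℚ.+ o ℚ.* S ℚ.* N      ≡⟨ cong (K ℚ.* S ℚ.* N ℚ.+_) (xy∙z≈xz∙y o S N) ⟩
  K ℚ.* S ℚ.* N ℚ.+ o ℚ.* N ℚ.* S      ≡⟨ cong₂ ℚ._+_ (cong (ℚ._* N) (sym (fromℕ-* k s))) (cong (ℚ._* S) (fraction-* a g)) ⟩
  fromℕ (k * s) ℚ.* N ℚ.+ fromℕ a ℚ.* S  ≡⟨ cong₂ ℚ._+_ (sym (fromℕ-* (k * s) (suc g))) (sym (fromℕ-* a s)) ⟩
  fromℕ (k * s * suc g) ℚ.+ fromℕ (a * s) ≡⟨ sym (fromℕ-+ (k * s * suc g) (a * s)) ⟩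
  fromℕ (k * s * suc g + a * s)        ∎
  where
  open ≡-Reasoning
  K = fromℕ k
  o = fraction a g
  S = fromℕ s
  N = fromℕ (suc g)

fraction-< : ∀ a g {δ} → (ℤ.+ a) ℤ.* ℚ.↧ δ ℤ.< ℚ.↥ δ ℤ.* ℤ.+[1+ g ] → fraction a g ℚ.< δ
fraction-< a g {record{}} lt =
  ℚ.toℚᵘ-cancel-< (ℚᵘ.<-respˡ-≃ (ℚᵘ.≃-sym (ℚ.toℚᵘ-fromℚᵘ (mkℚᵘ (ℤ.+ a) g))) (*<* lt))

0≤fraction : ∀ a g → 0ℚ ℚ.≤ fraction a g
0≤fraction a g = ℚ.toℚᵘ-cancel-≤ (ℚᵘ.≤-respʳ-≃ (ℚᵘ.≃-sym (ℚ.toℚᵘ-fromℚᵘ (mkℚᵘ (ℤ.+ a) g))) (ℚᵘ.nonNegative⁻¹ (mkℚᵘ (ℤ.+ a) g)))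

module _ (q : ℕ) .{{_ : NonZero q}} where

  -- For positive Δ this is a divided by the floor of the q-th root of Δ, that is, by the floor of
  -- y; at 0 it takes a default value.
  errorTerm : ℕ → ℕ → ℚ
  errorTerm a zero    = 0ℚ
  errorTerm a (suc Δ) = fraction a (proj₁ (floorRoot q (suc Δ)))

  errorTerm-null : ∀ a → TendsToZero (errorTerm a)
  errorTerm-null a δ 0<δ = go δ (ℚ.positive 0<δ)
    where
    go : ∀ δ → ℚ.Positive δ → ∃[ N ] (∀ n → N ≤ n → ℚ.∣ errorTerm a n ∣ ℚ.< δ)
    -- For δ = (p+1)/(d+1) the fraction is below δ as soon as the root exceeds a (d+1), since p + 1
    -- is at least 1.
    go δ@(mkℚ ℤ.+[1+ p ] d _) _ = suc (a * suc d) ^ q , small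
      where
      small : ∀ n → suc (a * suc d) ^ q ≤ n → ℚ.∣ errorTerm a n ∣ ℚ.< δ
      small zero le = ⊥-elim (<⇒≱ (m^n>0 (suc (a * suc d)) q) le)
      small (suc Δ) le with floorRoot q (suc Δ)
      ... | g , _ , upper = subst (ℚ._< _) (sym (ℚ.0≤p⇒∣p∣≡p (0≤fraction a g)))
        (fraction-< a g (subst₂ ℤ._<_ (ℤ.pos-* a (suc d)) (ℤ.pos-* (suc p) (suc g)) (ℤ.+<+
          (<-≤-trans (≤-pred (^-cancelˡ-< q (≤-<-trans le upper))) (m≤n*m (suc g) (suc p))))))

theorem12 : ExcludedMiddle 0ℓ →
    (m : ℕ) → 2 ≤ m →
    (F : Family) →
    (∀ H → F H → Connected H × Bipartite H × m ≤ size H) →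
    (kᵥ kₑ : ℕ) →
    NumberUpToIso (λ H → F H × order H ≤ m) kᵥ →
    NumberUpToIso (λ H → F H × size H ≡ m) kₑ →
    Σ[ χ ∈ (ℕ → ℕ) ]
    (∀ Δ → IsMaxChromaticNumber F Δ (χ Δ))
    × (∀ Δ → 1 ≤ Δ →
    χ Δ < fromℕ ((kᵥ + 71) * (m + 1)) · Δ ^⟨ m / m ∸ 1 ⟩)
    × (Σ[ o ∈ (ℕ → ℚ) ]
    TendsToZero o
    × (∀ Δ → 1 ≤ Δ →
    χ Δ < (fromℕ (kₑ + 1) ℚ.+ o Δ) ℚ.* fromℕ (m + 1) · Δ ^⟨ m / m ∸ 1 ⟩))
theorem12 em (suc (suc a)) (s≤s (s≤s z≤n)) F F-ok kᵥ kₑ numberᵥ numberₑ =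
  χ , isMax , absolute , errorTerm q E , errorTerm-null q E , asymptotic
  where
  q m : ℕ
  q = suc a
  m = suc q
  open Bounds em a F F-ok
  open Extremal em
  module Root (Δ : ℕ) .{{_ : NonZero Δ}} where
    root = floorRoot q (Δ ^ m) {{m^n≢0 Δ m}}
    h : ℕ
    h = suc (proj₁ root)
    h-root : IntegerRoot Δ h
    h-root = proj₂ root
    open SmallOrder kᵥ numberᵥ Δ h h-root public
      using () renaming (uniformlyColorable to uniformᵥ; colours to coloursᵥ; colours-< to coloursᵥ-<)
  open ExactSize kₑ numberₑ using (excess)
  uniform : ∀ Δ → ∃[ C ] UniformlyColorable Δ C
  -- The integer roots require Δ to be positive; a graph of maximum degree 0 is treated as one of
  -- maximum degree at most 1.
  uniform zero    = _ , λ G deg → Root.uniformᵥ 1 G λ v → ≤-trans (deg v) z≤n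
  uniform (suc Δ) = _ , Root.uniformᵥ (suc Δ)
  χ : ℕ → ℕ
  χ Δ = proj₁ (maxChromaticNumber F Δ (proj₂ (uniform Δ)))
  isMax : ∀ Δ → IsMaxChromaticNumber F Δ (χ Δ)
  isMax Δ = proj₂ (maxChromaticNumber F Δ (proj₂ (uniform Δ)))
  absolute : ∀ Δ → 1 ≤ Δ → χ Δ < fromℕ ((kᵥ + 71) * (m + 1)) · Δ ^⟨ m / q ⟩
  absolute (suc Δ) _ = <·^-intro q {g = 1} {h = h} (ℚ.*-identityʳ _) (proj₁ h-root) (begin-strict
    χ (suc Δ) * 1               ≡⟨ *-identityʳ (χ (suc Δ)) ⟩
    χ (suc Δ)                   ≤⟨ maxChromaticNumber-≤ (isMax (suc Δ)) uniformᵥ ⟩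
    coloursᵥ                    <⟨ coloursᵥ-< ⟩
    (kᵥ + 71) * (m + 1) * h     ≡⟨ *-comm _ h ⟩
    h * ((kᵥ + 71) * (m + 1))   ∎)
    where
    open ≤-Reasoning
    open Root (suc Δ)
  E : ℕ
  E = suc (kₑ + 1) * (m + 1) + excess
  asymptotic : ∀ Δ → 1 ≤ Δ → χ Δ < (fromℕ (kₑ + 1) ℚ.+ errorTerm q E Δ) ℚ.* fromℕ (m + 1) · Δ ^⟨ m / q ⟩
  asymptotic (suc Δ) _ = <·^-intro q {g = g} {h = h} {M = (kₑ + 1) * (m + 1) * g + E * (m + 1)}
    (clear-denominator (kₑ + 1) E (proj₁ g-root) (m + 1)) (proj₁ h-root) (begin-strict
    χ (suc Δ) * g                                   ≤⟨ *-monoˡ-≤ g (maxChromaticNumber-≤ (isMax (suc Δ)) uniformₑ) ⟩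
    coloursₑ * g                                    ≤⟨ <⇒≤ coloursₑ-< ⟩
    h * ((kₑ + 1) * (m + 1) * g + E)                <⟨ *-monoʳ-< h (+-monoʳ-< ((kₑ + 1) * (m + 1) * g) E<) ⟩
    h * ((kₑ + 1) * (m + 1) * g + E * (m + 1))      ∎)
    where
    open ≤-Reasoning
    open Root (suc Δ)
    g-root = floorRoot q (suc Δ)
    g = suc (proj₁ g-root)
    coloursₑ = ExactSize.colours kₑ numberₑ (suc Δ) h h-root
    uniformₑ = ExactSize.uniformlyColorable kₑ numberₑ (suc Δ) h h-root
    coloursₑ-< = ExactSize.colours-< kₑ numberₑ (suc Δ) h h-root {g} (proj₁ (proj₂ g-root))
    -- The error term is multiplied by m + 1 in the final bound, while `colours-<` leaves only E /
    -- g.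
    E< : E < E * (m + 1)
    E< = subst (_< E * (m + 1)) (*-identityʳ E) (*-monoʳ-< E {{_}} (s≤s (s≤s z≤n)))
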